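{- Let $\mathcal{F}$ be a union-closed family of finite sets with $\emptyset\in\mathcal{F}$, and let $U\in J(\mathcal{F})$. Let $\mathcal{G}=\{V\in J(\mathcal{F}): V\cap U\neq\emptyset\}$. Suppose that (i) $|U|=2$; (ii) $\mathcal{G}$ is a graph, i.e. every member of $\mathcal{G}$ has one or two elements; (iii) there is a simple graph $\mathcal{G}'\subseteq J(\mathcal{F})$ (every member of $\mathcal{G}'$ has exactly two elements) such that for every $V\in\mathcal{G}$ with $|V|=2$ we have $V\in\mathcal{G}'$ and $d_{\mathcal{G}'}(V)\ge d_{\mathcal{G}'}(U)$. Then $(\mathcal{F},U)$ has the density property, i.e. $|\{W\in\mathcal{F}: W\supseteq U\}|\le \frac12|\mathcal{F}|$.
   Context: $J(\mathcal{F})$ denotes the set of union generators of $\mathcal{F}$: the nonempty $V\in\mathcal{F}$ that are not equal to the union of the members of $\mathcal{F}$ properly contained in $V$; every member of $\mathcal{F}$ is a union of members of $J(\mathcal{F})$. For a family $\mathcal{H}$ of sets (a graph) and a set $V$, the degree of $V$ in $\mathcal{H}$ is $d_{\mathcal{H}}(V)=|\{W\in\mathcal{H}\setminus\{V\}: W\cap V\neq\emptyset\}|$. -}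

module Defs where

open import Data.Nat using (ℕ; zero; suc; _*_; _≤_)
open import Data.Bool using (Bool; true; false; _∧_; not)
import Data.Bool.Properties as BoolP
open import Data.List using (List; []; _∷_; [_]; map; _++_; filterᵇ; length)
open import Data.Vec using ([]; _∷_)
open import Data.Vec.Properties using (≡-dec)
open import Data.Fin.Subset using (Subset; _∪_; _∩_; ⋃; ∣_∣; Nonempty; ⊥)
open import Data.Fin.Subset.Properties using (_⊆?_; nonempty?)
open import Data.Product using (_×_)
open import Relation.Nullary.Decidable using (isYes)
open import Relation.Binary.PropositionalEquality using (_≡_; _≢_)

-- Sets are subsets of a finite ground set Fin n (the union of a finite
-- family of finite sets is finite).  A family of such sets is given by
-- its (Boolean) membership function, so it has no repeated members.
Family : ℕ → Set
Family n = Subset n → Bool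

_∈F_ : {n : ℕ} → Subset n → Family n → Set
V ∈F F = F V ≡ true

allSubsets : (n : ℕ) → List (Subset n)
allSubsets zero = [ [] ]
allSubsets (suc n) = map (false ∷_) (allSubsets n) ++ map (true ∷_) (allSubsets n)

members : {n : ℕ} → Family n → List (Subset n)
members {n} F = filterᵇ F (allSubsets n)

card : {n : ℕ} → Family n → ℕ
card F = length (members F)

UnionClosed : {n : ℕ} → Family n → Set
UnionClosed F = ∀ A B → A ∈F F → B ∈F F → (A ∪ B) ∈F F

eqᵇ : {n : ℕ} → Subset n → Subset n → Bool
eqᵇ W V = isYes (≡-dec BoolP._≟_ W V)

properSubᵇ : {n : ℕ} → Subset n → Subset n → Bool
properSubᵇ W V = isYes (W ⊆? V) ∧ not (eqᵇ W V)

unionBelow : {n : ℕ} → Family n → Subset n → Subset n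
unionBelow F V = ⋃ (filterᵇ (λ W → properSubᵇ W V) (members F))

IsJ : {n : ℕ} → Family n → Subset n → Set
IsJ F V = V ∈F F × Nonempty V × V ≢ unionBelow F V

degree : {n : ℕ} → Family n → Subset n → ℕ
degree H V = length (filterᵇ (λ W → not (eqᵇ W V) ∧ isYes (nonempty? (W ∩ V))) (members H))

DensityProperty : {n : ℕ} → Family n → Subset n → Set
DensityProperty F U = 2 * card (λ W → F W ∧ isYes (U ⊆? W)) ≤ card F

{-# OPTIONS --safe #-}

-- Let U = {u,v}, let A and B be the neighbours in G' of u and v outside U, let N x be those
-- of x, and call a point of S loose if no member of F inside S contains it.  Say that W ∈ F
-- with U ⊆ W is bad if none of W \ U, W \ {u}, W \ {v} is in F: then the loose points of
-- S = W \ U lie in A ∪ B, but neither all in A nor all in B.  The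
-- degree condition gives |N x| ≥ |B| for x ∈ A \ B and |N x| ≥ |A| for x ∈ B \ A.
--
-- The neighbours of a loose point x of S lie outside S, and adding any nonempty set of them
-- makes x covered.  Hence fixing the loose points in A \ B costs a factor 2^|A\B| - 1 and
-- adding neighbours gains a factor 2^|B| - 1; doing the same for B \ A afterwards bounds
-- the number of bad sets by
--   (2^|A\B| - 1)(2^|A| - 1 + 2^|B\A| - 1) / ((2^|A| - 1)(2^|B| - 1))
-- times the number of S avoiding U, meeting A and B, all of whose loose points lie in
-- A ∩ B.  For |A| ≤ |B| this factor is at most 2, and at most 1 if A ∩ B ≠ ∅.  Each such S
-- yields a member S ∪ {v} of F which is not needed to pay for sets that are not bad, and
-- also S ∪ {u} if A ∩ B = ∅.
module Submission where

open import Defs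
open import Data.Nat using (ℕ; zero; suc; _+_; _*_; _^_; _≤_; _<_; z≤n; s≤s; NonZero)
import Data.Nat.Properties as ℕ
open import Data.Nat.Induction using (<-wellFounded)
open import Data.Nat.Solver using (module +-*-Solver)
open import Data.Bool using (true; false; _∧_; not)
import Data.Bool.Properties as Bool
open import Data.Empty using (⊥-elim)
open import Data.Fin using (Fin; zero; suc; inject≤; toℕ)
open import Data.Fin.Properties using (injective⇒≤; suc-injective; any?; toℕ-inject≤; toℕ-injective)
  renaming (_≟_ to _≟ᶠ_)
open import Data.Fin.Subset
  using (Subset; _∈_; _∉_; _⊆_; _∪_; _∩_; ∁; ⋃; ⁅_⁆; ∣_∣; Nonempty; ⊥)
open import Data.Fin.Subset.Properties
open import Data.Vec using ([]; _∷_; here; there; tabulate)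
open import Data.Vec.Properties
  using (lookup∘tabulate; lookup⇒[]=; []=⇒lookup; ∷-injectiveʳ; ≡-dec)
open import Data.List
  using (List; []; _∷_; map; _++_; filter; filterᵇ; length; lookup; cartesianProduct; allFin)
open import Data.List.Properties using (length-++; length-map; length-tabulate)
open import Data.List.Extrema ℕ.≤-totalOrder using (argmin; f[argmin]≤f[xs]; argmin-all)
import Data.List.Relation.Unary.All as All
open import Data.List.Relation.Unary.All using ([]; _∷_)
open import Data.List.Relation.Unary.AllPairs using ([]; _∷_)
open import Data.List.Relation.Unary.Any using (here; there; index)
open import Data.List.Relation.Unary.Any.Properties using (lookup-index)
open import Data.List.Relation.Unary.Unique.Propositional using (Unique)
import Data.List.Relation.Unary.Unique.Propositional.Properties as Unique
open import Data.List.Membership.Propositional using () renaming (_∈_ to _∈ₗ_)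
open import Data.List.Membership.Propositional.Properties
open import Data.Product using (_×_; _,_; proj₁; proj₂; ∃; Σ)
open import Data.Sum using (_⊎_; inj₁; inj₂; [_,_]′)
open import Function using (_∘_; id; Equivalence)
open import Induction.WellFounded using (acc; Acc)
open import Relation.Nullary using (¬_; Dec; yes; no; does)
open import Relation.Nullary.Decidable
  using (_×-dec_; _⊎-dec_; ¬?; T?; dec-true; isYes; decidable-stable;
         toWitness; fromWitness; toWitnessFalse; fromWitnessFalse)
open import Relation.Unary using (Decidable)
open import Relation.Binary.PropositionalEquality

private variable
  X Y : Set
  n : ℕ

-- Counting by injections

lookup-injective : {xs : List X} → Unique xs → ∀ i j → lookup xs i ≡ lookup xs j → i ≡ j
lookup-injective (_ ∷ _) zero zero _ = refl
lookup-injective (x∉ ∷ _) zero (suc j) eq = ⊥-elim (All.lookup x∉ (∈-lookup j) eq)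
lookup-injective (x∉ ∷ _) (suc i) zero eq = ⊥-elim (All.lookup x∉ (∈-lookup i) (sym eq))
lookup-injective (_ ∷ u) (suc i) (suc j) eq = cong suc (lookup-injective u i j eq)

-- The injection is a relation, so that an image may be produced from a membership proof and
-- injectivity argued from what relates the two sides. Positions in the lists turn it into an
-- injection between `Fin` types.
injection⇒length≤ : (R : X → Y → Set) {xs : List X} {ys : List Y} → Unique xs
  → (∀ {x} → x ∈ₗ xs → ∃ λ y → y ∈ₗ ys × R x y)
  → (∀ {x x′ y} → x ∈ₗ xs → x′ ∈ₗ xs → R x y → R x′ y → x ≡ x′)
  → length xs ≤ length ys
injection⇒length≤ R {xs} {ys} uniq image injective = injective⇒≤ {f = f} f-injective
  where
  f : Fin (length xs) → Fin (length ys)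
  f i = index (proj₁ (proj₂ (image (∈-lookup {xs = xs} i))))

  f-related : ∀ i → R (lookup xs i) (lookup ys (f i))
  f-related i with image (∈-lookup {xs = xs} i)
  ... | _ , y∈ , r = subst (R _) (lookup-index y∈) r

  f-injective : ∀ {i j} → f i ≡ f j → i ≡ j
  f-injective {i} {j} eq = lookup-injective uniq i j
    (injective (∈-lookup i) (∈-lookup j) (f-related i)
      (subst (R _) (cong (lookup ys) (sym eq)) (f-related j)))

unique-⊆⇒length≤ : {xs ys : List X} → Unique xs → (∀ {x} → x ∈ₗ xs → x ∈ₗ ys)
  → length xs ≤ length ys
unique-⊆⇒length≤ uniq xs⊆ys =
  injection⇒length≤ _≡_ uniq (λ x∈ → _ , xs⊆ys x∈ , refl) λ { _ _ refl refl → refl }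

length-cartesianProduct : (xs : List X) (ys : List Y)
  → length (cartesianProduct xs ys) ≡ length xs * length ys
length-cartesianProduct [] ys = refl
length-cartesianProduct (x ∷ xs) ys = begin
  length (map (x ,_) ys ++ cartesianProduct xs ys)
    ≡⟨ length-++ (map (x ,_) ys) ⟩
  length (map (x ,_) ys) + length (cartesianProduct xs ys)
    ≡⟨ cong₂ _+_ (length-map (x ,_) ys) (length-cartesianProduct xs ys) ⟩
  length ys + length xs * length ys ∎
  where open ≡-Reasoning

infixr 5 _⊎ₗ_

-- Tagged concatenation: a single injection out of or into it handles a sum of two cardinalities.
_⊎ₗ_ : List X → List Y → List (X ⊎ Y)
xs ⊎ₗ ys = map inj₁ xs ++ map inj₂ ys

length-⊎ₗ : (xs : List X) (ys : List Y) → length (xs ⊎ₗ ys) ≡ length xs + length ys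
length-⊎ₗ xs ys =
  trans (length-++ (map inj₁ xs)) (cong₂ _+_ (length-map inj₁ xs) (length-map inj₂ ys))

∈-⊎ₗ⁺ˡ : {xs : List X} {ys : List Y} {x : X} → x ∈ₗ xs → inj₁ x ∈ₗ xs ⊎ₗ ys
∈-⊎ₗ⁺ˡ x∈ = ∈-++⁺ˡ (∈-map⁺ inj₁ x∈)

∈-⊎ₗ⁺ʳ : (xs : List X) {ys : List Y} {y : Y} → y ∈ₗ ys → inj₂ y ∈ₗ xs ⊎ₗ ys
∈-⊎ₗ⁺ʳ xs y∈ = ∈-++⁺ʳ (map inj₁ xs) (∈-map⁺ inj₂ y∈)

∈-⊎ₗ⁻ : (xs : List X) {ys : List Y} {p : X ⊎ Y} → p ∈ₗ xs ⊎ₗ ys → [ _∈ₗ xs , _∈ₗ ys ]′ p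
∈-⊎ₗ⁻ xs p∈ with ∈-++⁻ (map inj₁ xs) p∈
... | inj₁ p∈ˡ with ∈-map⁻ inj₁ p∈ˡ
...   | _ , x∈ , refl = x∈
∈-⊎ₗ⁻ xs p∈ | inj₂ p∈ʳ with ∈-map⁻ inj₂ p∈ʳ
...   | _ , y∈ , refl = y∈

⊎ₗ-unique : {xs : List X} {ys : List Y} → Unique xs → Unique ys → Unique (xs ⊎ₗ ys)
⊎ₗ-unique u-xs u-ys = Unique.++⁺ (Unique.map⁺ (λ { refl → refl }) u-xs)
  (Unique.map⁺ (λ { refl → refl }) u-ys) disjoint
  where
  disjoint : ∀ {p} → ¬ (p ∈ₗ map inj₁ _ × p ∈ₗ map inj₂ _)
  disjoint (p∈ˡ , p∈ʳ) with ∈-map⁻ inj₁ p∈ˡ | ∈-map⁻ inj₂ p∈ʳ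
  ... | _ , _ , refl | _ , _ , ()

-- Subsets of Fin n

module _ {P : Fin n → Set} (P? : Decidable P) where

  ⟦_⟧ : Subset n
  ⟦_⟧ = tabulate (does ∘ P?)

  ∈⟦⟧⁺ : ∀ {i} → P i → i ∈ ⟦_⟧
  ∈⟦⟧⁺ {i} p = lookup⇒[]= i _ (trans (lookup∘tabulate _ i) (dec-true (P? i) p))

  ∈⟦⟧⁻ : ∀ {i} → i ∈ ⟦_⟧ → P i
  ∈⟦⟧⁻ {i} i∈ with P? i | trans (sym (lookup∘tabulate (does ∘ P?) i)) ([]=⇒lookup i∈)
  ... | yes p | _ = p
  ... | no _ | ()

⊆∧∣≥∣⇒⊇ : {p q : Subset n} → p ⊆ q → ∣ q ∣ ≤ ∣ p ∣ → q ⊆ p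
⊆∧∣≥∣⇒⊇ {p = p} {q} p⊆q q≤p {x} x∈q with x ∈? p
... | yes x∈p = x∈p
... | no x∉p = ⊥-elim (ℕ.<⇒≱ (p⊂q⇒∣p∣<∣q∣ (p⊆q , x , x∈q , x∉p)) q≤p)

elements : Subset n → List (Fin n)
elements [] = []
elements (true ∷ p) = zero ∷ map suc (elements p)
elements (false ∷ p) = map suc (elements p)

length-elements : (p : Subset n) → length (elements p) ≡ ∣ p ∣
length-elements [] = refl
length-elements (true ∷ p) = cong suc (trans (length-map suc (elements p)) (length-elements p))
length-elements (false ∷ p) = trans (length-map suc (elements p)) (length-elements p)

∈-elements⁺ : {p : Subset n} {i : Fin n} → i ∈ p → i ∈ₗ elements p
∈-elements⁺ here = here refl
∈-elements⁺ {p = true ∷ p} (there i∈) = there (∈-map⁺ suc (∈-elements⁺ i∈))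
∈-elements⁺ {p = false ∷ p} (there i∈) = ∈-map⁺ suc (∈-elements⁺ i∈)

∈-elements⁻ : (p : Subset n) {i : Fin n} → i ∈ₗ elements p → i ∈ p
∈-elements⁻ (true ∷ p) (here refl) = here
∈-elements⁻ (true ∷ p) (there i∈) with ∈-map⁻ suc i∈
... | _ , j∈ , refl = there (∈-elements⁻ p j∈)
∈-elements⁻ (false ∷ p) i∈ with ∈-map⁻ suc i∈
... | _ , j∈ , refl = there (∈-elements⁻ p j∈)

elements-unique : (p : Subset n) → Unique (elements p)
elements-unique [] = []
elements-unique (true ∷ p) = All.tabulate zero∉ ∷ Unique.map⁺ suc-injective (elements-unique p)
  where
  zero∉ : ∀ {j} → j ∈ₗ map suc (elements p) → zero ≢ j
  zero∉ j∈ with ∈-map⁻ suc j∈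
  ... | _ , _ , refl = λ ()
elements-unique (false ∷ p) = Unique.map⁺ suc-injective (elements-unique p)

∷-disjoint : {xs ys : List (Subset n)} {S : Subset (suc n)}
  → ¬ (S ∈ₗ map (false ∷_) xs × S ∈ₗ map (true ∷_) ys)
∷-disjoint (∈₁ , ∈₂) with ∈-map⁻ _ ∈₁ | ∈-map⁻ _ ∈₂
... | _ , _ , refl | _ , _ , ()

-- The length of this list is the number 2^c - 1 that occurs in all factors of the count.
nonemptySubsets : Subset n → List (Subset n)
nonemptySubsets [] = []
nonemptySubsets (false ∷ p) = map (false ∷_) (nonemptySubsets p)
nonemptySubsets (true ∷ p) =
  -- Once the first point is present the rest may be empty, hence the extra `⊥`.
  map (false ∷_) (nonemptySubsets p) ++ map (true ∷_) (⊥ ∷ nonemptySubsets p)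

-- The `suc` on the left avoids truncated subtraction.
length-nonemptySubsets : (p : Subset n) → suc (length (nonemptySubsets p)) ≡ 2 ^ ∣ p ∣
length-nonemptySubsets [] = refl
length-nonemptySubsets (false ∷ p) =
  trans (cong suc (length-map _ (nonemptySubsets p))) (length-nonemptySubsets p)
length-nonemptySubsets (true ∷ p) = begin
  suc (length (map (false ∷_) (nonemptySubsets p) ++ map (true ∷_) (⊥ ∷ nonemptySubsets p)))
    ≡⟨ cong suc (length-++ (map (false ∷_) (nonemptySubsets p))) ⟩
  suc (length (map (false ∷_) (nonemptySubsets p)) + length (map (true ∷_) (⊥ ∷ nonemptySubsets p)))
    ≡⟨ cong₂ (λ k l → suc (k + l)) (length-map _ (nonemptySubsets p))
         (length-map _ (⊥ ∷ nonemptySubsets p)) ⟩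
  suc (length (nonemptySubsets p)) + suc (length (nonemptySubsets p))
    ≡⟨ cong₂ _+_ (length-nonemptySubsets p) (trans (length-nonemptySubsets p) (sym (ℕ.+-identityʳ _))) ⟩
  2 ^ ∣ p ∣ + (2 ^ ∣ p ∣ + 0) ∎
  where open ≡-Reasoning

∈-nonemptySubsets⁺ : {p q : Subset n} → p ⊆ q → Nonempty p → p ∈ₗ nonemptySubsets q
∈-nonemptySubsets⁺ {p = true ∷ p} {false ∷ q} p⊆q _ with p⊆q here
... | ()
∈-nonemptySubsets⁺ {p = true ∷ p} {true ∷ q} p⊆q _ with nonempty? p
... | yes ne = ∈-++⁺ʳ _ (∈-map⁺ _ (there (∈-nonemptySubsets⁺ (drop-∷-⊆ p⊆q) ne)))
... | no ¬ne = ∈-++⁺ʳ _ (∈-map⁺ _ (here (Empty-unique ¬ne)))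
∈-nonemptySubsets⁺ {p = false ∷ p} {false ∷ q} p⊆q (suc i , there i∈) =
  ∈-map⁺ _ (∈-nonemptySubsets⁺ (drop-∷-⊆ p⊆q) (i , i∈))
∈-nonemptySubsets⁺ {p = false ∷ p} {true ∷ q} p⊆q (suc i , there i∈) =
  ∈-++⁺ˡ (∈-map⁺ _ (∈-nonemptySubsets⁺ (drop-∷-⊆ p⊆q) (i , i∈)))

∈-nonemptySubsets⁻ : (q : Subset n) {p : Subset n} → p ∈ₗ nonemptySubsets q → p ⊆ q × Nonempty p
∈-nonemptySubsets⁻ (false ∷ q) p∈ with ∈-map⁻ _ p∈
... | _ , p∈ , refl with ∈-nonemptySubsets⁻ q p∈
...   | p⊆q , i , i∈ = out⊆ p⊆q , suc i , there i∈
∈-nonemptySubsets⁻ (true ∷ q) p∈ with ∈-++⁻ (map (false ∷_) (nonemptySubsets q)) p∈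
... | inj₂ p∈ʳ with ∈-map⁻ _ p∈ʳ
...   | _ , here refl , refl = in⊆in ⊥⊆ , zero , here
...   | _ , there r∈ , refl = in⊆in (proj₁ (∈-nonemptySubsets⁻ q r∈)) , zero , here
∈-nonemptySubsets⁻ (true ∷ q) p∈ | inj₁ p∈ˡ with ∈-map⁻ _ p∈ˡ
...   | _ , r∈ , refl with ∈-nonemptySubsets⁻ q r∈
...     | r⊆q , i , i∈ = out⊆ r⊆q , suc i , there i∈

nonemptySubsets-unique : (p : Subset n) → Unique (nonemptySubsets p)
nonemptySubsets-unique [] = []
nonemptySubsets-unique (false ∷ p) = Unique.map⁺ ∷-injectiveʳ (nonemptySubsets-unique p)
nonemptySubsets-unique (true ∷ p) = Unique.++⁺
  (Unique.map⁺ ∷-injectiveʳ (nonemptySubsets-unique p))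
  (Unique.map⁺ ∷-injectiveʳ (All.tabulate ⊥∉ ∷ nonemptySubsets-unique p))
  ∷-disjoint
  where
  ⊥∉ : ∀ {q} → q ∈ₗ nonemptySubsets p → ⊥ ≢ q
  ⊥∉ q∈ refl = ∉⊥ (proj₂ (proj₂ (∈-nonemptySubsets⁻ p q∈)))

∈-allSubsets : (S : Subset n) → S ∈ₗ allSubsets n
∈-allSubsets [] = here refl
∈-allSubsets (false ∷ S) = ∈-++⁺ˡ (∈-map⁺ _ (∈-allSubsets S))
∈-allSubsets (true ∷ S) = ∈-++⁺ʳ _ (∈-map⁺ _ (∈-allSubsets S))

allSubsets-unique : ∀ n → Unique (allSubsets n)
allSubsets-unique zero = [] ∷ []
allSubsets-unique (suc n) = Unique.++⁺
  (Unique.map⁺ ∷-injectiveʳ (allSubsets-unique n))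
  (Unique.map⁺ ∷-injectiveʳ (allSubsets-unique n)) ∷-disjoint

module _ {P : Subset n → Set} (P? : Decidable P) where

  -- As `allSubsets` has no repetitions, the length of this list is the number of sets with property
  -- `P`; every count below has this form.
  select : List (Subset n)
  select = filter P? (allSubsets n)

  ∈-select⁺ : ∀ {S} → P S → S ∈ₗ select
  ∈-select⁺ = ∈-filter⁺ P? (∈-allSubsets _)

  ∈-select⁻ : ∀ {S} → S ∈ₗ select → P S
  ∈-select⁻ = proj₂ ∘ ∈-filter⁻ P? {xs = allSubsets n}

  select-unique : Unique select
  select-unique = Unique.filter⁺ P? (allSubsets-unique n)

minimiser : (f : Fin n → ℕ) (p : Subset n) → Nonempty p
  → ∃ λ x → x ∈ p × ∀ {y} → y ∈ p → f x ≤ f y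
minimiser f p (x₀ , x₀∈) =
  argmin f x₀ (elements p) ,
  argmin-all f x₀∈ (All.tabulate (∈-elements⁻ p)) ,
  λ y∈ → All.lookup (f[argmin]≤f[xs] x₀ (elements p)) (∈-elements⁺ y∈)

_∈F?_ : (W : Subset n) (F : Family n) → Dec (W ∈F F)
W ∈F? F = F W Bool.≟ true

infix 4 _∈F?_
infixl 7 _∖_

_∖_ : Subset n → Fin n → Subset n
W ∖ w = ⟦ (λ x → x ∈? W ×-dec ¬? (x ≟ᶠ w)) ⟧

∈∖⁺ : {W : Subset n} {w x : Fin n} → x ∈ W → x ≢ w → x ∈ W ∖ w
∈∖⁺ {W = W} {w} x∈W x≢w = ∈⟦⟧⁺ (λ x → x ∈? W ×-dec ¬? (x ≟ᶠ w)) (x∈W , x≢w)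

∈∖⁻ : (W : Subset n) {w x : Fin n} → x ∈ W ∖ w → x ∈ W × x ≢ w
∈∖⁻ W {w} = ∈⟦⟧⁻ (λ x → x ∈? W ×-dec ¬? (x ≟ᶠ w))

∈⁅⁆∪⁅⁆⁻ : {x y z : Fin n} → z ∈ ⁅ x ⁆ ∪ ⁅ y ⁆ → z ≡ x ⊎ z ≡ y
∈⁅⁆∪⁅⁆⁻ z∈ with x∈p∪q⁻ _ _ z∈
... | inj₁ z∈x = inj₁ (x∈⁅y⁆⇒x≡y _ z∈x)
... | inj₂ z∈y = inj₂ (x∈⁅y⁆⇒x≡y _ z∈y)

⁅⁆∪⁅⁆⊆ : {x y : Fin n} {S : Subset n} → x ∈ S → y ∈ S → ⁅ x ⁆ ∪ ⁅ y ⁆ ⊆ S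
⁅⁆∪⁅⁆⊆ x∈S y∈S z∈ with ∈⁅⁆∪⁅⁆⁻ z∈
... | inj₁ refl = x∈S
... | inj₂ refl = y∈S

∈⁅⁆∪⁅⁆ˡ : {x y : Fin n} → x ∈ ⁅ x ⁆ ∪ ⁅ y ⁆
∈⁅⁆∪⁅⁆ˡ = x∈p∪q⁺ (inj₁ (x∈⁅x⁆ _))

∈⁅⁆∪⁅⁆ʳ : {x y : Fin n} → y ∈ ⁅ x ⁆ ∪ ⁅ y ⁆
∈⁅⁆∪⁅⁆ʳ = x∈p∪q⁺ (inj₂ (x∈⁅x⁆ _))

nonemptySubsets-mono : (p q : Subset n) → ∣ p ∣ ≤ ∣ q ∣
  → length (nonemptySubsets p) ≤ length (nonemptySubsets q)
nonemptySubsets-mono p q p≤q = ℕ.≤-pred (subst₂ _≤_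
  (sym (length-nonemptySubsets p)) (sym (length-nonemptySubsets q)) (ℕ.^-monoʳ-≤ 2 p≤q))

-- Covered and loose points

module Covering (F : Family n) (closed : UnionClosed F) (⊥∈F : ⊥ ∈F F) where

  -- The covered points form the largest member of `F` inside `S`.
  Covered : Subset n → Fin n → Set
  Covered S x = ∃ λ W → W ∈F F × x ∈ W × W ⊆ S

  covered? : ∀ S x → Dec (Covered S x)
  covered? S x = anySubset? (λ W → W ∈F? F ×-dec (x ∈? W ×-dec W ⊆? S))

  covered-mono : ∀ {S R x} → S ⊆ R → Covered S x → Covered R x
  covered-mono S⊆R (W , W∈F , x∈W , W⊆S) = W , W∈F , x∈W , ⊆-trans W⊆S S⊆R

  -- `S` is the union of the members that cover its points; the union is built point by point,
  -- starting from `⊥`.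
  covered⇒∈F : ∀ {S} → (∀ {x} → x ∈ S → Covered S x) → S ∈F F
  covered⇒∈F {S} cov with covering (elements S) (∈-elements⁻ S)
    where
    covering : ∀ xs → (∀ {x} → x ∈ₗ xs → x ∈ S)
      → ∃ λ V → V ∈F F × V ⊆ S × (∀ {x} → x ∈ₗ xs → x ∈ V)
    covering [] _ = ⊥ , ⊥∈F , ⊥⊆ , λ ()
    covering (x ∷ xs) xs⊆S with covering xs (xs⊆S ∘ there) | cov (xs⊆S (here refl))
    ... | V , V∈F , V⊆S , xs⊆V | W , W∈F , x∈W , W⊆S =
      V ∪ W , closed V W V∈F W∈F ,
      [ V⊆S , W⊆S ]′ ∘ x∈p∪q⁻ V W ,
      λ { (here refl) → x∈p∪q⁺ (inj₂ x∈W) ; (there y∈) → x∈p∪q⁺ (inj₁ (xs⊆V y∈)) }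
  ... | V , V∈F , V⊆S , S⊆V =
    subst (_∈F F) (⊆-antisym V⊆S (S⊆V ∘ ∈-elements⁺)) V∈F

  loose? : ∀ S → Decidable (λ x → x ∈ S × ¬ Covered S x)
  loose? S x = x ∈? S ×-dec ¬? (covered? S x)

  loose : Subset n → Subset n
  loose S = ⟦ loose? S ⟧

  ∈-loose⁺ : ∀ {S x} → x ∈ S → ¬ Covered S x → x ∈ loose S
  ∈-loose⁺ {S} x∈S ¬cov = ∈⟦⟧⁺ (loose? S) (x∈S , ¬cov)

  ∈-loose⁻ : ∀ S {x} → x ∈ loose S → x ∈ S × ¬ Covered S x
  ∈-loose⁻ S = ∈⟦⟧⁻ (loose? S)

  loose-empty⇒∈F : ∀ {S} → ¬ Nonempty (loose S) → S ∈F F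
  loose-empty⇒∈F {S} empty = covered⇒∈F λ {x} x∈S →
    decidable-stable (covered? S x) (λ ¬cov → empty (x , ∈-loose⁺ x∈S ¬cov))

  covered-or-loose : ∀ {S x} → x ∈ S → Covered S x ⊎ x ∈ loose S
  covered-or-loose {S} {x} x∈S with covered? S x
  ... | yes cov = inj₁ cov
  ... | no ¬cov = inj₂ (∈-loose⁺ x∈S ¬cov)

  -- Here `X` is `S` with `w` added. An edge from `w` to each loose point covers that point, and an
  -- edge from `w` to a point of `S ∩ D` covers `w` even if nothing is loose.
  attach : ∀ {w D S X} → (∀ {x} → x ∈ D → (⁅ w ⁆ ∪ ⁅ x ⁆) ∈F F)
    → w ∈ X → S ⊆ X → (∀ {x} → x ∈ X → x ≡ w ⊎ x ∈ S)
    → loose S ⊆ D → Nonempty (S ∩ D) → X ∈F F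
  attach {w} {D} {S} {X} edge w∈X S⊆X X⊆ loose⊆D (y , y∈) = covered⇒∈F cover
    where
    edge-at : ∀ {x} → x ∈ S → x ∈ D → ∀ {z} → z ∈ ⁅ w ⁆ ∪ ⁅ x ⁆ → Covered X z
    edge-at x∈S x∈D z∈ = _ , edge x∈D , z∈ , ⁅⁆∪⁅⁆⊆ w∈X (S⊆X x∈S)
    cover : ∀ {x} → x ∈ X → Covered X x
    cover x∈X with X⊆ x∈X
    ... | inj₁ refl = edge-at (proj₁ (x∈p∩q⁻ S D y∈)) (proj₂ (x∈p∩q⁻ S D y∈)) ∈⁅⁆∪⁅⁆ˡ
    ... | inj₂ x∈S with covered-or-loose x∈S
    ...   | inj₁ cov = covered-mono S⊆X cov
    ...   | inj₂ lo = edge-at x∈S (loose⊆D lo) ∈⁅⁆∪⁅⁆ʳ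

  -- Covering loose points by adding neighbours

  module Extension (N : Fin n → Subset n)
    (N-edge : ∀ {x z} → z ∈ N x → (⁅ x ⁆ ∪ ⁅ z ⁆) ∈F F)
    (Base : Subset n → Set) (Base? : Decidable Base)
    (Base-extend : ∀ {S R} → S ⊆ R → (∀ {z} → z ∈ R → z ∈ S ⊎ ∃ λ x → z ∈ N x) → Base S → Base R)
    where

    Level : Subset n → Subset n → Set
    Level D S = Base S × loose S ⊆ D

    level? : ∀ D → Decidable (Level D)
    level? D S = Base? S ×-dec loose S ⊆? D

    -- The loose points in `A` are those to be covered, after which all loose points lie in `D`. In
    -- the application the first argument is first `A ∩ ∁ B`, with `D = B`, and then `B ∩ ∁ A`, with
    -- `D = A ∩ B`.
    Source : Subset n → Subset n → Subset n → Set
    Source A D S = Base S × loose S ⊆ A ∪ D × Nonempty (loose S ∩ A)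

    source? : ∀ A D → Decidable (Source A D)
    source? A D S = Base? S ×-dec (loose S ⊆? (A ∪ D) ×-dec nonempty? (loose S ∩ A))

    hull? : ∀ Q → Decidable (λ z → ∃ λ x → x ∈ Q × z ∈ N x)
    hull? Q z = any? (λ x → x ∈? Q ×-dec z ∈? N x)

    hull : Subset n → Subset n
    hull Q = ⟦ hull? Q ⟧

    ∈-hull⁺ : ∀ {Q x z} → x ∈ Q → z ∈ N x → z ∈ hull Q
    ∈-hull⁺ {Q} x∈Q z∈Nx = ∈⟦⟧⁺ (hull? Q) (_ , x∈Q , z∈Nx)

    ∈-hull⁻ : ∀ Q {z} → z ∈ hull Q → ∃ λ x → x ∈ Q × z ∈ N x
    ∈-hull⁻ Q = ∈⟦⟧⁻ (hull? Q)

    -- A neighbourhood N x of least cardinality among x ∈ Q.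
    pivot : Subset n → Subset n
    pivot Q with nonempty? Q
    ... | yes ne = N (proj₁ (minimiser (∣_∣ ∘ N) Q ne))
    ... | no _ = ⊥

    pivot-spec : ∀ {Q} → Nonempty Q
      → ∃ λ x → x ∈ Q × pivot Q ≡ N x × (∀ {y} → y ∈ Q → ∣ pivot Q ∣ ≤ ∣ N y ∣)
    pivot-spec {Q} ne with nonempty? Q
    ... | no empty = ⊥-elim (empty ne)
    ... | yes ne′ = let x , x∈Q , least = minimiser (∣_∣ ∘ N) Q ne′ in x , x∈Q , refl , least

    extend? : ∀ Q K S → Decidable (λ z → z ∈ S ⊎ (z ∈ hull Q × z ∉ pivot Q) ⊎ z ∈ K)
    extend? Q K S z = z ∈? S ⊎-dec ((z ∈? hull Q ×-dec ¬? (z ∈? pivot Q)) ⊎-dec z ∈? K)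

    -- The only freedom is the choice of `K` inside the pivot; all other neighbours of `Q` are added
    -- wholesale. Since `hull Q` and `pivot Q` depend on `Q` alone, `S` and `K` can be read off from
    -- the result once `Q` is known.
    extend : Subset n → Subset n → Subset n → Subset n
    extend Q K S = ⟦ extend? Q K S ⟧

    ∈-extend⁺ : ∀ {Q K S z} → z ∈ S ⊎ (z ∈ hull Q × z ∉ pivot Q) ⊎ z ∈ K → z ∈ extend Q K S
    ∈-extend⁺ {Q} {K} {S} = ∈⟦⟧⁺ (extend? Q K S)

    ∈-extend⁻ : ∀ Q K S {z} → z ∈ extend Q K S → z ∈ S ⊎ (z ∈ hull Q × z ∉ pivot Q) ⊎ z ∈ K
    ∈-extend⁻ Q K S = ∈⟦⟧⁻ (extend? Q K S)

    module _ {A D S K : Subset n} (source : Source A D S)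
      (K⊆ : K ⊆ pivot (loose S ∩ A)) (K-nonempty : Nonempty K) where

      private
        Q R : Subset n
        Q = loose S ∩ A
        R = extend Q K S

      pivot⊆hull : pivot Q ⊆ hull Q
      pivot⊆hull z∈ with pivot-spec (proj₂ (proj₂ source))
      ... | x , x∈Q , eq , _ = ∈-hull⁺ x∈Q (subst (_ ∈_) eq z∈)

      Q⊆S : Q ⊆ S
      Q⊆S = proj₁ ∘ ∈-loose⁻ S ∘ p∩q⊆p (loose S) A

      -- A neighbour inside `S` would give an edge inside `S` that covers the loose point.
      S-hull-disjoint : ∀ {z} → z ∈ S → z ∉ hull Q
      S-hull-disjoint z∈S z∈hull with ∈-hull⁻ Q z∈hull
      ... | x , x∈Q , z∈Nx = proj₂ (∈-loose⁻ S (p∩q⊆p (loose S) A x∈Q))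
        (_ , N-edge z∈Nx , ∈⁅⁆∪⁅⁆ˡ , ⁅⁆∪⁅⁆⊆ (Q⊆S x∈Q) z∈S)

      S⊆R : S ⊆ R
      S⊆R = ∈-extend⁺ {Q} {K} {S} ∘ inj₁

      R⊆S∪hull : ∀ {z} → z ∈ R → z ∈ S ⊎ z ∈ hull Q
      R⊆S∪hull z∈R with ∈-extend⁻ Q K S z∈R
      ... | inj₁ z∈S = inj₁ z∈S
      ... | inj₂ (inj₁ (z∈hull , _)) = inj₂ z∈hull
      ... | inj₂ (inj₂ z∈K) = inj₂ (pivot⊆hull (K⊆ z∈K))

      -- If N y ⊆ pivot Q then both have the same size, so K ⊆ N y.
      dominated : ∀ {y} → y ∈ Q → ∃ λ z → z ∈ N y × z ∈ R
      dominated {y} y∈Q with any? (λ z → z ∈? N y ×-dec ¬? (z ∈? pivot Q))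
      ... | yes (z , z∈Ny , z∉pivot) = z , z∈Ny , ∈-extend⁺ (inj₂ (inj₁ (∈-hull⁺ y∈Q z∈Ny , z∉pivot)))
      ... | no ¬outside =
        let z , z∈K = K-nonempty
            _ , _ , _ , least = pivot-spec (proj₂ (proj₂ source))
            Ny⊆pivot : N y ⊆ pivot Q
            Ny⊆pivot {w} w∈Ny = decidable-stable (w ∈? pivot Q) (λ w∉ → ¬outside (w , w∈Ny , w∉))
        in z , ⊆∧∣≥∣⇒⊇ Ny⊆pivot (least y∈Q) (K⊆ z∈K) , ∈-extend⁺ (inj₂ (inj₂ z∈K))

      -- An added point is covered by its edge to a point of `Q`, and a point of `Q` by its edge to
      -- the neighbour from `dominated`. What was covered in `S` stays covered, so only loose points
      -- of `S` in `D` can remain.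
      extend-loose⊆ : loose R ⊆ D
      extend-loose⊆ {y} y∈loose with ∈-loose⁻ R y∈loose
      ... | y∈R , ¬cov with R⊆S∪hull y∈R
      ...   | inj₂ y∈hull =
        let x , x∈Q , y∈Nx = ∈-hull⁻ Q y∈hull
        in ⊥-elim (¬cov (_ , N-edge y∈Nx , ∈⁅⁆∪⁅⁆ʳ , ⁅⁆∪⁅⁆⊆ (S⊆R (Q⊆S x∈Q)) y∈R))
      ...   | inj₁ y∈S with covered-or-loose y∈S
      ...     | inj₁ cov = ⊥-elim (¬cov (covered-mono S⊆R cov))
      ...     | inj₂ y∈looseS with x∈p∪q⁻ A D (proj₁ (proj₂ source) y∈looseS)
      ...       | inj₂ y∈D = y∈D
      ...       | inj₁ y∈A =
        let z , z∈Ny , z∈R = dominated (x∈p∩q⁺ (y∈looseS , y∈A))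
        in ⊥-elim (¬cov (_ , N-edge z∈Ny , ∈⁅⁆∪⁅⁆ˡ , ⁅⁆∪⁅⁆⊆ y∈R z∈R))

      extend-level : Level D R
      extend-level =
        Base-extend S⊆R ([ inj₁ , inj₂ ∘ (λ { (x , _ , z∈) → x , z∈ }) ∘ ∈-hull⁻ Q ]′ ∘ R⊆S∪hull)
          (proj₁ source) ,
        extend-loose⊆

      extend-recover-S : ∀ {z} → z ∈ R → z ∉ hull Q → z ∈ S
      extend-recover-S z∈R z∉hull = [ id , ⊥-elim ∘ z∉hull ]′ (R⊆S∪hull z∈R)

      extend-recover-K : ∀ {z} → z ∈ R → z ∈ pivot Q → z ∈ K
      extend-recover-K z∈R z∈pivot with ∈-extend⁻ Q K S z∈R
      ... | inj₁ z∈S = ⊥-elim (S-hull-disjoint z∈S (pivot⊆hull z∈pivot))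
      ... | inj₂ (inj₁ (_ , z∉pivot)) = ⊥-elim (z∉pivot z∈pivot)
      ... | inj₂ (inj₂ z∈K) = z∈K

    -- `S` is the part of the extension outside `hull Q`, and `K` is its part inside `pivot Q`. Only
    -- inclusions are stated; exchanging the two sides yields the equalities.
    extend-injective : ∀ {A D S S′ K K′} → Source A D S → Source A D S′
      → loose S ∩ A ≡ loose S′ ∩ A
      → K ⊆ pivot (loose S ∩ A) → K′ ⊆ pivot (loose S′ ∩ A) → Nonempty K → Nonempty K′
      → extend (loose S ∩ A) K S ≡ extend (loose S′ ∩ A) K′ S′ → S ⊆ S′ × K ⊆ K′
    extend-injective {A} {D} {S} {S′} {K} {K′} src src′ Q≡ K⊆ K′⊆ ne ne′ R≡ =
      (λ z∈S → extend-recover-S src′ K′⊆ ne′ (subst (_ ∈_) R≡ (∈-extend⁺ (inj₁ z∈S)))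
         (S-hull-disjoint src K⊆ ne z∈S ∘ subst (λ Q → _ ∈ hull Q) (sym Q≡))) ,
      (λ z∈K → extend-recover-K src′ K′⊆ ne′ (subst (_ ∈_) R≡ (∈-extend⁺ (inj₂ (inj₂ z∈K))))
         (subst (λ Q → _ ∈ pivot Q) Q≡ (K⊆ z∈K)))

    -- Each source has at least `m` extensions, one for each of the first `m` choices of `K`. The
    -- pair of `Q = loose S ∩ A` and the extension determines both `S` and the choice; there are at
    -- most `length (nonemptySubsets A)` possible `Q`.
    source-bound : ∀ A D m → (∀ {x} → x ∈ A → m ≤ length (nonemptySubsets (N x)))
      → length (select (source? A D)) * m
        ≤ length (nonemptySubsets A) * length (select (level? D))
    source-bound A D m large = subst₂ _≤_
      (trans (length-cartesianProduct (select (source? A D)) (allFin m))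
             (cong (length (select (source? A D)) *_) (length-tabulate {n = m} id)))
      (length-cartesianProduct (nonemptySubsets A) (select (level? D)))
      (injection⇒length≤ Extends
        (Unique.cartesianProduct⁺ (select-unique (source? A D)) (Unique.allFin⁺ m))
        image injective)
      where
      cells : Subset n → List (Subset n)
      cells S = nonemptySubsets (pivot (loose S ∩ A))

      -- The number of cells varies with `S`, so the uniform index `i` is matched with a position
      -- `j` of the same numerical value.
      Extends : Subset n × Fin m → Subset n × Subset n → Set
      Extends (S , i) (Q , R) = Q ≡ loose S ∩ A × ∃ λ (j : Fin (length (cells S))) →
        toℕ j ≡ toℕ i × R ≡ extend (loose S ∩ A) (lookup (cells S) j) S

      cell : ∀ S j → lookup (cells S) j ⊆ pivot (loose S ∩ A) × Nonempty (lookup (cells S) j)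
      cell S j = ∈-nonemptySubsets⁻ (pivot (loose S ∩ A)) (∈-lookup j)

      source : ∀ {S i} → (S , i) ∈ₗ cartesianProduct (select (source? A D)) (allFin m) → Source A D S
      source p∈ = ∈-select⁻ (source? A D) (proj₁ (∈-cartesianProduct⁻ _ (allFin m) p∈))

      image : ∀ {p} → p ∈ₗ cartesianProduct (select (source? A D)) (allFin m)
        → ∃ λ q → q ∈ₗ cartesianProduct (nonemptySubsets A) (select (level? D)) × Extends p q
      image {S , i} p∈ =
        (loose S ∩ A , extend (loose S ∩ A) (lookup (cells S) j) S) ,
        ∈-cartesianProduct⁺ (∈-nonemptySubsets⁺ (p∩q⊆q (loose S) A) (proj₂ (proj₂ src)))
          (∈-select⁺ (level? D) (extend-level src (proj₁ (cell S j)) (proj₂ (cell S j)))) ,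
        refl , j , toℕ-inject≤ i m≤ , refl
        where
        src : Source A D S
        src = source p∈
        m≤ : m ≤ length (cells S)
        -- The pivot is the neighbourhood of a point of `A`, so the assumption on `m` applies to it.
        m≤ with pivot-spec (proj₂ (proj₂ src))
        ... | x , x∈Q , eq , _ =
          subst (λ M → m ≤ length (nonemptySubsets M)) (sym eq) (large (p∩q⊆q (loose S) A x∈Q))
        j : Fin (length (cells S))
        j = inject≤ i m≤

      injective : ∀ {p p′ q} → p ∈ₗ cartesianProduct (select (source? A D)) (allFin m)
        → p′ ∈ₗ cartesianProduct (select (source? A D)) (allFin m)
        → Extends p q → Extends p′ q → p ≡ p′
      injective {S , i} {S′ , i′} p∈ p′∈ (Q≡ , j , j≡i , R≡) (Q≡′ , j′ , j′≡i′ , R≡′)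
        with ⊆-antisym (proj₁ there-inclusions) (proj₁ back-inclusions)
           | ⊆-antisym (proj₂ there-inclusions) (proj₂ back-inclusions)
        where
        there-inclusions : S ⊆ S′ × lookup (cells S) j ⊆ lookup (cells S′) j′
        there-inclusions = extend-injective (source p∈) (source p′∈) (trans (sym Q≡) Q≡′)
          (proj₁ (cell S j)) (proj₁ (cell S′ j′)) (proj₂ (cell S j)) (proj₂ (cell S′ j′))
          (trans (sym R≡) R≡′)
        back-inclusions : S′ ⊆ S × lookup (cells S′) j′ ⊆ lookup (cells S) j
        back-inclusions = extend-injective (source p′∈) (source p∈) (trans (sym Q≡′) Q≡)
          (proj₁ (cell S′ j′)) (proj₁ (cell S j)) (proj₂ (cell S′ j′)) (proj₂ (cell S j))
          (trans (sym R≡′) R≡)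
      -- With `S` and `S′` identified the two lists of cells coincide, and equal entries of a list
      -- without repetitions have equal positions.
      ... | refl | K≡ = cong (S ,_) (toℕ-injective (trans (sym j≡i) (trans
        (cong toℕ (lookup-injective (nonemptySubsets-unique (pivot (loose S ∩ A))) j j′ K≡)) j′≡i′)))

-- Used with p, q, α, β the numbers 2^c - 1 for c = |A|, |B|, |A \ B|, |B \ A|, and
-- k = 1 or 2, according to whether A ∩ B is empty or not.
scaled-bound : ∀ k {s l m r p q α β} .{{_ : NonZero p}} .{{_ : NonZero q}}
  → s * q ≤ α * l → l ≤ m + r → m * p ≤ β * r
  → k * α ≤ p → β ≤ q → p ≤ q → k * s ≤ 2 * r
scaled-bound k {s} {l} {m} {r} {p} {q} {α} {β} sq≤αl l≤m+r mp≤βr kα≤p β≤q p≤q =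
  ℕ.*-cancelʳ-≤ (k * s) (2 * r) (q * p) {{ℕ.m*n≢0 q p}} (begin
    k * s * (q * p)
      ≡⟨ solve 4 (λ k s q p → k :* s :* (q :* p) := k :* p :* (s :* q)) refl k s q p ⟩
    k * p * (s * q)
      ≤⟨ ℕ.*-monoʳ-≤ (k * p) (ℕ.≤-trans sq≤αl (ℕ.*-monoʳ-≤ α l≤m+r)) ⟩
    k * p * (α * (m + r))
      ≡⟨ solve 5 (λ k p α m r → k :* p :* (α :* (m :+ r)) := k :* α :* (m :* p :+ r :* p))
           refl k p α m r ⟩
    k * α * (m * p + r * p)
      ≤⟨ ℕ.*-mono-≤ kα≤p (ℕ.+-monoˡ-≤ (r * p) mp≤βr) ⟩
    p * (β * r + r * p)
      ≤⟨ ℕ.*-monoʳ-≤ p (ℕ.+-mono-≤ (ℕ.*-monoˡ-≤ r β≤q) (ℕ.*-monoʳ-≤ r p≤q)) ⟩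
    p * (q * r + r * q)
      ≡⟨ solve 3 (λ p q r → p :* (q :* r :+ r :* q) := con 2 :* r :* (q :* p)) refl p q r ⟩
    2 * r * (q * p) ∎)
  where
  open ℕ.≤-Reasoning
  open +-*-Solver

-- For a = |p|, doubling 2^a - 1 gives 2^(a+1) - 2, one less than 2^(a+1) - 1; `n≤1+n` gives this
-- one away. It serves the case where `A` and `B` meet, so that `A ∩ ∁ B` is smaller than `A`.
nonemptySubsets-double : (p q : Subset n) → ∣ p ∣ < ∣ q ∣
  → 2 * length (nonemptySubsets p) ≤ length (nonemptySubsets q)
nonemptySubsets-double p q p<q = ℕ.≤-pred (ℕ.≤-trans (ℕ.n≤1+n _) (begin
  2 + 2 * length (nonemptySubsets p) ≡⟨ ℕ.*-distribˡ-+ 2 1 (length (nonemptySubsets p)) ⟨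
  2 * suc (length (nonemptySubsets p)) ≡⟨ cong (2 *_) (length-nonemptySubsets p) ⟩
  2 ^ suc ∣ p ∣                      ≤⟨ ℕ.^-monoʳ-≤ 2 p<q ⟩
  2 ^ ∣ q ∣                          ≡⟨ length-nonemptySubsets q ⟨
  suc (length (nonemptySubsets q))   ∎))
  where open ℕ.≤-Reasoning

nonemptySubsets-nonZero : {p : Subset n} → Nonempty p → NonZero (length (nonemptySubsets p))
nonemptySubsets-nonZero {p = p} ne with nonemptySubsets p | ∈-nonemptySubsets⁺ ⊆-refl ne
... | _ ∷ _ | _ = _

∩-monoˡ : {S R D : Subset n} → S ⊆ R → Nonempty (S ∩ D) → Nonempty (R ∩ D)
∩-monoˡ {S = S} {D = D} S⊆R (x , x∈) =
  let x∈S , x∈D = x∈p∩q⁻ S D x∈ in x , x∈p∩q⁺ (S⊆R x∈S , x∈D)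

∪⁅⁆∖ : {S : Subset n} {w : Fin n} → w ∉ S → (S ∪ ⁅ w ⁆) ∖ w ≡ S
∪⁅⁆∖ {S = S} {w} w∉S = ⊆-antisym to λ x∈S → ∈∖⁺ (x∈p∪q⁺ (inj₁ x∈S)) λ { refl → w∉S x∈S }
  where
  to : (S ∪ ⁅ w ⁆) ∖ w ⊆ S
  to x∈ with ∈∖⁻ (S ∪ ⁅ w ⁆) x∈
  ... | x∈∪ , x≢w with x∈p∪q⁻ S ⁅ w ⁆ x∈∪
  ...   | inj₁ x∈S = x∈S
  ...   | inj₂ x∈w = ⊥-elim (x≢w (x∈⁅y⁆⇒x≡y w x∈w))

∪⁅⁆-avoids : {S : Subset n} {w w′ : Fin n} → w ∉ S → w ≢ w′ → w ∉ S ∪ ⁅ w′ ⁆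
∪⁅⁆-avoids {S = S} {w} {w′} w∉S w≢w′ = [ w∉S , w≢w′ ∘ x∈⁅y⁆⇒x≡y w′ ]′ ∘ x∈p∪q⁻ S ⁅ w′ ⁆

∪⁅⁆-injective : {S S′ : Subset n} {w : Fin n} → w ∉ S → w ∉ S′ → S ∪ ⁅ w ⁆ ≡ S′ ∪ ⁅ w ⁆ → S ≡ S′
∪⁅⁆-injective {w = w} w∉S w∉S′ eq =
  trans (sym (∪⁅⁆∖ w∉S)) (trans (cong (_∖ w) eq) (∪⁅⁆∖ w∉S′))

∖∪⁅⁆ : {W : Subset n} {w : Fin n} → w ∈ W → W ∖ w ∪ ⁅ w ⁆ ≡ W
∖∪⁅⁆ {W = W} {w} w∈W = ⊆-antisym
  ([ proj₁ ∘ ∈∖⁻ W , (λ x∈ → subst (_∈ W) (sym (x∈⁅y⁆⇒x≡y w x∈)) w∈W) ]′ ∘ x∈p∪q⁻ (W ∖ w) ⁅ w ⁆)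
  from
  where
  from : W ⊆ W ∖ w ∪ ⁅ w ⁆
  from {x} x∈W with x ≟ᶠ w
  ... | yes refl = x∈p∪q⁺ (inj₂ (x∈⁅x⁆ w))
  ... | no x≢w = x∈p∪q⁺ (inj₁ (∈∖⁺ x∈W x≢w))

-- Counting bad sets

-- All that the count uses of the graph. The fields are symmetric under exchanging `u` with `v` and
-- `A` with `B`. `cover` says that removing `u` and `v` from a member can make only points of `A`
-- and `B` loose.
record Neighbourhoods (F : Family n) (u v : Fin n) : Set where
  field
    A B      : Subset n
    N        : Fin n → Subset n
    u≢v      : u ≢ v
    A-edge   : ∀ {x} → x ∈ A → (⁅ u ⁆ ∪ ⁅ x ⁆) ∈F F
    B-edge   : ∀ {x} → x ∈ B → (⁅ v ⁆ ∪ ⁅ x ⁆) ∈F F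
    N-edge   : ∀ {x z} → z ∈ N x → (⁅ x ⁆ ∪ ⁅ z ⁆) ∈F F
    N-avoids : ∀ {x z} → z ∈ N x → z ≢ u × z ≢ v
    A-degree : ∀ {x} → x ∈ A → x ∉ B → ∣ B ∣ ≤ ∣ N x ∣
    B-degree : ∀ {x} → x ∈ B → x ∉ A → ∣ A ∣ ≤ ∣ N x ∣
    cover    : ∀ {W x} → W ∈F F → x ∈ W → x ≢ u → x ≢ v
             → x ∈ A ⊎ x ∈ B ⊎ ∃ λ V → V ∈F F × x ∈ V × V ⊆ W × u ∉ V × v ∉ V

-- This permits the assumption |A| ≤ |B|.
exchange : {F : Family n} {u v : Fin n} → Neighbourhoods F u v → Neighbourhoods F v u
exchange {F = F} {u} {v} nbhd = record
  { A = B ; B = A ; N = N ; u≢v = u≢v ∘ sym ; A-edge = B-edge ; B-edge = A-edge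
  ; N-edge = N-edge ; N-avoids = λ z∈ → proj₂ (N-avoids z∈) , proj₁ (N-avoids z∈)
  ; A-degree = B-degree ; B-degree = A-degree ; cover = cover′
  }
  where
  open Neighbourhoods nbhd
  cover′ : ∀ {W x} → W ∈F F → x ∈ W → x ≢ v → x ≢ u
    → x ∈ B ⊎ x ∈ A ⊎ ∃ λ V → V ∈F F × x ∈ V × V ⊆ W × v ∉ V × u ∉ V
  cover′ W∈F x∈W x≢v x≢u with cover W∈F x∈W x≢u x≢v
  ... | inj₁ x∈A = inj₂ (inj₁ x∈A)
  ... | inj₂ (inj₁ x∈B) = inj₁ x∈B
  ... | inj₂ (inj₂ (V , V∈F , x∈V , V⊆W , u∉V , v∉V)) =
    inj₂ (inj₂ (V , V∈F , x∈V , V⊆W , v∉V , u∉V))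

module Density (F : Family n) (closed : UnionClosed F) (⊥∈F : ⊥ ∈F F)
  {u v : Fin n} (nbhd : Neighbourhoods F u v) where

  open Neighbourhoods nbhd
  open Covering F closed ⊥∈F

  C : Subset n
  C = A ∩ B

  -- Meeting `A` and `B` is what lets `u` and `v` be attached at the end, even when no point is
  -- loose. The whole condition survives adding neighbours, since these are never `u` or `v`.
  Base : Subset n → Set
  Base S = (u ∉ S × v ∉ S) × Nonempty (S ∩ A) × Nonempty (S ∩ B)

  base? : Decidable Base
  base? S = (¬? (u ∈? S) ×-dec ¬? (v ∈? S)) ×-dec (nonempty? (S ∩ A) ×-dec nonempty? (S ∩ B))

  base-extend : ∀ {S R} → S ⊆ R → (∀ {z} → z ∈ R → z ∈ S ⊎ ∃ λ x → z ∈ N x) → Base S → Base R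
  base-extend S⊆R R⊆ ((u∉S , v∉S) , meetsA , meetsB) =
    ( [ u∉S , (λ { (_ , u∈N) → proj₁ (N-avoids u∈N) refl }) ]′ ∘ R⊆
    , [ v∉S , (λ { (_ , v∈N) → proj₂ (N-avoids v∈N) refl }) ]′ ∘ R⊆ ) ,
    ∩-monoˡ S⊆R meetsA , ∩-monoˡ S⊆R meetsB

  open Extension N N-edge Base base? base-extend

  -- The cases are whether or not some loose point lies in `B` outside `A`; if so, the second round
  -- of extensions applies.
  level-split : length (select (level? B))
    ≤ length (select (source? (B ∩ ∁ A) C)) + length (select (level? C))
  level-split = subst (length (select (level? B)) ≤_)
    (length-++ (select (source? (B ∩ ∁ A) C)))
    (unique-⊆⇒length≤ (select-unique (level? B)) (place ∘ ∈-select⁻ (level? B)))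
    where
    place : ∀ {S} → Level B S → S ∈ₗ select (source? (B ∩ ∁ A) C) ++ select (level? C)
    place {S} (base , loose⊆B) with nonempty? (loose S ∩ (B ∩ ∁ A))
    ... | yes ne = ∈-++⁺ˡ (∈-select⁺ (source? (B ∩ ∁ A) C) (base , split , ne))
      where
      split : loose S ⊆ (B ∩ ∁ A) ∪ C
      split {x} x∈ with x ∈? A
      ... | yes x∈A = x∈p∪q⁺ (inj₂ (x∈p∩q⁺ (x∈A , loose⊆B x∈)))
      ... | no x∉A = x∈p∪q⁺ (inj₁ (x∈p∩q⁺ (loose⊆B x∈ , x∉p⇒x∈∁p x∉A)))
    ... | no empty = ∈-++⁺ʳ (select (source? (B ∩ ∁ A) C)) (∈-select⁺ (level? C) (base , inside))
      where
      inside : loose S ⊆ C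
      inside {x} x∈ = x∈p∩q⁺
        ( decidable-stable (x ∈? A) (λ x∉A →
            empty (x , x∈p∩q⁺ (x∈ , x∈p∩q⁺ (loose⊆B x∈ , x∉p⇒x∈∁p x∉A))))
        , loose⊆B x∈ )

  Bad : Subset n → Set
  Bad W = W ∈F F × (u ∈ W × v ∈ W)
    × ¬ ((W ∖ u ∖ v) ∈F F) × ¬ ((W ∖ u) ∈F F) × ¬ ((W ∖ v) ∈F F)

  bad? : Decidable Bad
  bad? W = W ∈F? F ×-dec ((u ∈? W ×-dec v ∈? W) ×-dec
    (¬? (W ∖ u ∖ v ∈F? F) ×-dec (¬? (W ∖ u ∈F? F) ×-dec ¬? (W ∖ v ∈F? F))))

  ∈∖∖⁻ : ∀ W {x} → x ∈ W ∖ u ∖ v → x ∈ W × x ≢ u × x ≢ v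
  ∈∖∖⁻ W x∈ = let x∈′ , x≢v = ∈∖⁻ (W ∖ u) x∈ ; x∈W , x≢u = ∈∖⁻ W x∈′ in x∈W , x≢u , x≢v

  ∈∖∖⁺ : ∀ {W x} → x ∈ W → x ≢ u → x ≢ v → x ∈ W ∖ u ∖ v
  ∈∖∖⁺ x∈W x≢u x≢v = ∈∖⁺ (∈∖⁺ x∈W x≢u) x≢v

  -- In the third case of `cover` the member avoids `u` and `v`, so it lies inside `W ∖ u ∖ v` and
  -- covers the point.
  loose⊆A∪B : ∀ {W x} → W ∈F F → x ∈ loose (W ∖ u ∖ v) → x ∈ A ⊎ x ∈ B
  loose⊆A∪B {W} W∈F x∈ with ∈-loose⁻ (W ∖ u ∖ v) x∈
  ... | x∈S , ¬cov with ∈∖∖⁻ W x∈S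
  ...   | x∈W , x≢u , x≢v with cover W∈F x∈W x≢u x≢v
  ...     | inj₁ x∈A = inj₁ x∈A
  ...     | inj₂ (inj₁ x∈B) = inj₂ x∈B
  ...     | inj₂ (inj₂ (V , V∈F , x∈V , V⊆W , u∉V , v∉V)) =
    ⊥-elim (¬cov (V , V∈F , x∈V , λ z∈V →
      ∈∖∖⁺ (V⊆W z∈V) (λ { refl → u∉V z∈V }) (λ { refl → v∉V z∈V })))

  -- When all loose points lie in `B`, their edges to `v` survive the removal of `u`.
  attach∖u : ∀ {W} → v ∈ W → loose (W ∖ u ∖ v) ⊆ B → Nonempty (loose (W ∖ u ∖ v)) → (W ∖ u) ∈F F
  attach∖u {W} v∈W loose⊆B (x , x∈) = attach {S = W ∖ u ∖ v} B-edge (∈∖⁺ v∈W (u≢v ∘ sym))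
    (proj₁ ∘ ∈∖⁻ (W ∖ u)) back loose⊆B
    (x , x∈p∩q⁺ (proj₁ (∈-loose⁻ (W ∖ u ∖ v) x∈) , loose⊆B x∈))
    where
    back : ∀ {x} → x ∈ W ∖ u → x ≡ v ⊎ x ∈ W ∖ u ∖ v
    back {x} x∈ with x ≟ᶠ v
    ... | yes x≡v = inj₁ x≡v
    ... | no x≢v = inj₂ (∈∖⁺ x∈ x≢v)

  attach∖v : ∀ {W} → u ∈ W → loose (W ∖ u ∖ v) ⊆ A → Nonempty (loose (W ∖ u ∖ v)) → (W ∖ v) ∈F F
  attach∖v {W} u∈W loose⊆A (x , x∈) = attach {S = W ∖ u ∖ v} A-edge (∈∖⁺ u∈W u≢v)
    (λ x∈ → let x∈W , _ , x≢v = ∈∖∖⁻ W x∈ in ∈∖⁺ x∈W x≢v) back loose⊆A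
    (x , x∈p∩q⁺ (proj₁ (∈-loose⁻ (W ∖ u ∖ v) x∈) , loose⊆A x∈))
    where
    back : ∀ {x} → x ∈ W ∖ v → x ≡ u ⊎ x ∈ W ∖ u ∖ v
    back {x} x∈ with x ≟ᶠ u | ∈∖⁻ W x∈
    ... | yes x≡u | _ = inj₁ x≡u
    ... | no x≢u | x∈W , x≢v = inj₂ (∈∖∖⁺ x∈W x≢u x≢v)

  -- That `W ∖ u ∖ v` is not in `F` provides a loose point. By `attach∖u` and `attach∖v`, the
  -- absence of `W ∖ u` then forces a loose point outside `B`, and that of `W ∖ v` one outside `A`.
  bad⇒source : ∀ {W} → Bad W → Source (A ∩ ∁ B) B (W ∖ u ∖ v)
  bad⇒source {W} (W∈F , (u∈W , v∈W) , S∉F , W∖u∉F , W∖v∉F) =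
    ( ( (λ u∈S → proj₁ (proj₂ (∈∖∖⁻ W u∈S)) refl) , λ v∈S → proj₂ (proj₂ (∈∖∖⁻ W v∈S)) refl )
    , (let x , x∈ , x∈A , _ = privateA in x , x∈p∩q⁺ (proj₁ (∈-loose⁻ S x∈) , x∈A))
    , (let x , x∈ , x∈B = privateB in x , x∈p∩q⁺ (proj₁ (∈-loose⁻ S x∈) , x∈B)) ) ,
    split ,
    (let x , x∈ , x∈A , x∉B = privateA in x , x∈p∩q⁺ (x∈ , x∈p∩q⁺ (x∈A , x∉p⇒x∈∁p x∉B)))
    where
    S : Subset n
    S = W ∖ u ∖ v

    loose-nonempty : Nonempty (loose S)
    loose-nonempty = decidable-stable (nonempty? (loose S)) (S∉F ∘ loose-empty⇒∈F)

    privateA : ∃ λ x → x ∈ loose S × x ∈ A × x ∉ B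
    privateA with nonempty? (loose S ∩ ∁ B)
    ... | no empty = ⊥-elim (W∖u∉F (attach∖u v∈W (λ {x} x∈ → decidable-stable (x ∈? B) (λ x∉B →
            empty (x , x∈p∩q⁺ (x∈ , x∉p⇒x∈∁p x∉B)))) loose-nonempty))
    ... | yes (x , x∈) with x∈p∩q⁻ (loose S) (∁ B) x∈
    ...   | x∈loose , x∈∁B with loose⊆A∪B W∈F x∈loose
    ...     | inj₁ x∈A = x , x∈loose , x∈A , x∈∁p⇒x∉p x∈∁B
    ...     | inj₂ x∈B = ⊥-elim (x∈∁p⇒x∉p x∈∁B x∈B)

    privateB : ∃ λ x → x ∈ loose S × x ∈ B
    privateB with nonempty? (loose S ∩ ∁ A)
    ... | no empty = ⊥-elim (W∖v∉F (attach∖v u∈W (λ {x} x∈ → decidable-stable (x ∈? A) (λ x∉A →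
            empty (x , x∈p∩q⁺ (x∈ , x∉p⇒x∈∁p x∉A)))) loose-nonempty))
    ... | yes (x , x∈) with x∈p∩q⁻ (loose S) (∁ A) x∈
    ...   | x∈loose , x∈∁A with loose⊆A∪B W∈F x∈loose
    ...     | inj₁ x∈A = ⊥-elim (x∈∁p⇒x∉p x∈∁A x∈A)
    ...     | inj₂ x∈B = x , x∈loose , x∈B

    split : loose S ⊆ (A ∩ ∁ B) ∪ B
    split {x} x∈ with x ∈? B | loose⊆A∪B W∈F x∈
    ... | yes x∈B | _ = x∈p∪q⁺ (inj₂ x∈B)
    ... | no x∉B | inj₁ x∈A = x∈p∪q⁺ (inj₁ (x∈p∩q⁺ (x∈A , x∉p⇒x∈∁p x∉B)))
    ... | no x∉B | inj₂ x∈B = ⊥-elim (x∉B x∈B)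

  ∖∖-injective : ∀ {W W′} → u ∈ W′ × v ∈ W′ → W ∖ u ∖ v ≡ W′ ∖ u ∖ v → W ⊆ W′
  ∖∖-injective {W} {W′} (u∈W′ , v∈W′) eq {x} x∈W with x ≟ᶠ u | x ≟ᶠ v
  ... | yes refl | _ = u∈W′
  ... | no _ | yes refl = v∈W′
  ... | no x≢u | no x≢v = proj₁ (∈∖∖⁻ W′ (subst (x ∈_) eq (∈∖∖⁺ x∈W x≢u x≢v)))

  bad≤source : length (select bad?) ≤ length (select (source? (A ∩ ∁ B) B))
  bad≤source = injection⇒length≤ (λ W S → W ∖ u ∖ v ≡ S) (select-unique bad?)
    (λ W∈ → _ , ∈-select⁺ (source? (A ∩ ∁ B) B) (bad⇒source (∈-select⁻ bad? W∈)) , refl)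
    (λ W∈ W′∈ eq eq′ → ⊆-antisym
      (∖∖-injective (proj₁ (proj₂ (∈-select⁻ bad? W′∈))) (trans eq (sym eq′)))
      (∖∖-injective (proj₁ (proj₂ (∈-select⁻ bad? W∈))) (trans eq′ (sym eq))))

  -- Two rounds of `source-bound`, first for `A ∩ ∁ B` and then for `B ∩ ∁ A`, joined by
  -- `level-split`. The degree conditions supply the lower bounds on the neighbourhoods.
  bad-bound : ∀ k → ∣ A ∣ ≤ ∣ B ∣
    → k * length (nonemptySubsets (A ∩ ∁ B)) ≤ length (nonemptySubsets A)
    → k * length (select bad?) ≤ 2 * length (select (level? C))
  -- A bad set shows that `A` and `B` are nonempty, so that the numbers to be cancelled are not
  -- zero.
  bad-bound k A≤B kα≤p with anySubset? bad?
  ... | no none = begin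
    k * length (select bad?)
      ≤⟨ ℕ.*-monoʳ-≤ k (unique-⊆⇒length≤ {ys = []} (select-unique bad?)
           λ W∈ → ⊥-elim (none (_ , ∈-select⁻ bad? W∈))) ⟩
    k * 0 ≡⟨ ℕ.*-zeroʳ k ⟩
    0     ≤⟨ z≤n ⟩
    2 * length (select (level? C)) ∎
    where open ℕ.≤-Reasoning
  ... | yes (W , bad) = scaled-bound k
    {{nonemptySubsets-nonZero meetsA}} {{nonemptySubsets-nonZero meetsB}}
    (ℕ.≤-trans (ℕ.*-monoˡ-≤ (length (nonemptySubsets B)) bad≤source)
      (source-bound (A ∩ ∁ B) B _ λ {x} x∈ → let x∈A , x∈∁B = x∈p∩q⁻ A (∁ B) x∈ in
        nonemptySubsets-mono B (N x) (A-degree x∈A (x∈∁p⇒x∉p x∈∁B))))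
    level-split
    (source-bound (B ∩ ∁ A) C _ λ {x} x∈ → let x∈B , x∈∁A = x∈p∩q⁻ B (∁ A) x∈ in
        nonemptySubsets-mono A (N x) (B-degree x∈B (x∈∁p⇒x∉p x∈∁A)))
    kα≤p (nonemptySubsets-mono (B ∩ ∁ A) B (∣p∩q∣≤∣p∣ B (∁ A)))
    (nonemptySubsets-mono A B A≤B)
    where
    base : Base (W ∖ u ∖ v)
    base = proj₁ (bad⇒source bad)
    meetsA : Nonempty A
    meetsA = let _ , (x , x∈) , _ = base in x , p∩q⊆q (W ∖ u ∖ v) A x∈
    meetsB : Nonempty B
    meetsB = let _ , _ , (x , x∈) = base in x , p∩q⊆q (W ∖ u ∖ v) B x∈

  -- Members of F left over after each nonbad W ⊇ {u,v} has been sent to the first of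
  -- W ∖ u ∖ v, W ∖ v, W ∖ u that lies in F.
  Spare : Subset n → Set
  Spare Y = Y ∈F F × ((u ∈ Y × v ∉ Y × (Y ∖ u) ∈F F)
                      ⊎ (v ∈ Y × u ∉ Y × (Y ∖ v ∪ ⁅ u ⁆) ∈F F))

  spare? : Decidable Spare
  spare? Y = Y ∈F? F ×-dec ((u ∈? Y ×-dec (¬? (v ∈? Y) ×-dec Y ∖ u ∈F? F))
                      ⊎-dec (v ∈? Y ×-dec (¬? (u ∈? Y) ×-dec (Y ∖ v ∪ ⁅ u ⁆) ∈F? F)))

  attach∪ : ∀ {w D S} → (∀ {x} → x ∈ D → (⁅ w ⁆ ∪ ⁅ x ⁆) ∈F F)
    → loose S ⊆ D → Nonempty (S ∩ D) → (S ∪ ⁅ w ⁆) ∈F F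
  attach∪ {w} {D} {S} edge = attach edge (x∈p∪q⁺ (inj₂ (x∈⁅x⁆ w))) (p⊆p∪q ⁅ w ⁆)
    ([ inj₂ , inj₁ ∘ x∈⁅y⁆⇒x≡y w ]′ ∘ x∈p∪q⁻ S ⁅ w ⁆)

  -- All loose points are joined to both `u` and `v`, so `S ∪ ⁅ u ⁆` and `S ∪ ⁅ v ⁆` are both in
  -- `F`; the former makes the latter spare.
  level-∪v-spare : ∀ {S} → Level C S → Spare (S ∪ ⁅ v ⁆)
  level-∪v-spare {S} (((u∉S , v∉S) , meetsA , meetsB) , loose⊆C) =
    attach∪ B-edge (p∩q⊆q A B ∘ loose⊆C) meetsB ,
    inj₂ (x∈p∪q⁺ (inj₂ (x∈⁅x⁆ v)) , ∪⁅⁆-avoids u∉S u≢v ,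
      subst (λ R → (R ∪ ⁅ u ⁆) ∈F F) (sym (∪⁅⁆∖ v∉S)) (attach∪ A-edge (p∩q⊆p A B ∘ loose⊆C) meetsA))

  -- With `C` empty nothing is loose, so `S` itself is in `F`.
  level-∪u-spare : ∀ {S} → ¬ Nonempty C → Level C S → Spare (S ∪ ⁅ u ⁆)
  level-∪u-spare {S} C-empty (((u∉S , v∉S) , meetsA , meetsB) , loose⊆C) =
    attach∪ A-edge (p∩q⊆p A B ∘ loose⊆C) meetsA ,
    inj₁ (x∈p∪q⁺ (inj₂ (x∈⁅x⁆ u)) , ∪⁅⁆-avoids v∉S (u≢v ∘ sym) ,
      subst (_∈F F) (sym (∪⁅⁆∖ u∉S)) (loose-empty⇒∈F λ { (x , x∈) → C-empty (x , loose⊆C x∈) }))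

  level≤spare : length (select (level? C)) ≤ length (select spare?)
  level≤spare = injection⇒length≤ (λ S Y → S ∪ ⁅ v ⁆ ≡ Y) (select-unique (level? C))
    (λ S∈ → _ , ∈-select⁺ spare? (level-∪v-spare (∈-select⁻ (level? C) S∈)) , refl)
    (λ S∈ S′∈ eq eq′ → ∪⁅⁆-injective (v∉ S∈) (v∉ S′∈) (trans eq (sym eq′)))
    where
    v∉ : ∀ {S} → S ∈ₗ select (level? C) → v ∉ S
    v∉ S∈ = let ((_ , v∉S) , _) , _ = ∈-select⁻ (level? C) S∈ in v∉S

  2level≤spare : ¬ Nonempty C → 2 * length (select (level? C)) ≤ length (select spare?)
  2level≤spare C-empty = subst (_≤ length (select spare?))
    (trans (length-⊎ₗ L L) (cong (length L +_) (sym (ℕ.+-identityʳ (length L)))))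
    (injection⇒length≤ Attached (⊎ₗ-unique (select-unique (level? C)) (select-unique (level? C)))
      image injective)
    where
    L : List (Subset n)
    L = select (level? C)

    Attached : Subset n ⊎ Subset n → Subset n → Set
    Attached (inj₁ S) Y = Y ≡ S ∪ ⁅ u ⁆
    Attached (inj₂ S) Y = Y ≡ S ∪ ⁅ v ⁆

    level-of₁ : ∀ {S} → inj₁ S ∈ₗ L ⊎ₗ L → Level C S
    level-of₁ p∈ = ∈-select⁻ (level? C) (∈-⊎ₗ⁻ L p∈)

    level-of₂ : ∀ {S} → inj₂ S ∈ₗ L ⊎ₗ L → Level C S
    level-of₂ p∈ = ∈-select⁻ (level? C) (∈-⊎ₗ⁻ L p∈)

    image : ∀ {p} → p ∈ₗ L ⊎ₗ L → ∃ λ Y → Y ∈ₗ select spare? × Attached p Y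
    image {inj₁ S} p∈ = _ , ∈-select⁺ spare? (level-∪u-spare C-empty (level-of₁ p∈)) , refl
    image {inj₂ S} p∈ = _ , ∈-select⁺ spare? (level-∪v-spare (level-of₂ p∈)) , refl

    clash : ∀ {S S′} → Level C S′ → S ∪ ⁅ u ⁆ ≢ S′ ∪ ⁅ v ⁆
    clash (((u∉S′ , _) , _) , _) eq =
      ∪⁅⁆-avoids u∉S′ u≢v (subst (u ∈_) eq (x∈p∪q⁺ (inj₂ (x∈⁅x⁆ u))))

    injective : ∀ {p p′ Y} → p ∈ₗ L ⊎ₗ L → p′ ∈ₗ L ⊎ₗ L
      → Attached p Y → Attached p′ Y → p ≡ p′
    injective {inj₁ S} {inj₁ S′} p∈ p′∈ eq eq′ =
      let ((u∉S , _) , _) , _ = level-of₁ p∈ ; ((u∉S′ , _) , _) , _ = level-of₁ p′∈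
      in cong inj₁ (∪⁅⁆-injective u∉S u∉S′ (trans (sym eq) eq′))
    injective {inj₂ S} {inj₂ S′} p∈ p′∈ eq eq′ =
      let ((_ , v∉S) , _) , _ = level-of₂ p∈ ; ((_ , v∉S′) , _) , _ = level-of₂ p′∈
      in cong inj₂ (∪⁅⁆-injective v∉S v∉S′ (trans (sym eq) eq′))
    injective {inj₁ S} {inj₂ S′} p∈ p′∈ eq eq′ = ⊥-elim (clash (level-of₂ p′∈) (trans (sym eq) eq′))
    injective {inj₂ S} {inj₁ S′} p∈ p′∈ eq eq′ = ⊥-elim (clash (level-of₂ p∈) (trans (sym eq′) eq))

  -- If `C` is empty, there may be two bad sets for each set of the last level, but each such set
  -- yields two spare members. Otherwise `A ∩ ∁ B` is smaller than `A`, the factor improves to 1,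
  -- and one spare member suffices.
  bad≤spare : ∣ A ∣ ≤ ∣ B ∣ → length (select bad?) ≤ length (select spare?)
  bad≤spare A≤B with nonempty? C
  ... | no C-empty = ℕ.≤-trans (ℕ.≤-reflexive (sym (ℕ.*-identityˡ _))) (ℕ.≤-trans
    (bad-bound 1 A≤B (ℕ.≤-trans (ℕ.≤-reflexive (ℕ.*-identityˡ _))
      (nonemptySubsets-mono (A ∩ ∁ B) A (∣p∩q∣≤∣p∣ A (∁ B)))))
    (2level≤spare C-empty))
  ... | yes (x , x∈C) = ℕ.≤-trans
    (ℕ.*-cancelˡ-≤ 2 (bad-bound 2 A≤B (nonemptySubsets-double (A ∩ ∁ B) A (p⊂q⇒∣p∣<∣q∣
      (p∩q⊆p A (∁ B) , x , p∩q⊆p A B x∈C , λ x∈ → x∈∁p⇒x∉p (p∩q⊆q A (∁ B) x∈) (p∩q⊆q A B x∈C))))))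
    level≤spare

  -- Pairing the sets that are not bad

  Above Beside Nonbad Nonspare : Subset n → Set
  Above W = W ∈F F × (u ∈ W × v ∈ W)
  Beside Y = Y ∈F F × ¬ (u ∈ Y × v ∈ Y)
  Nonbad W = Above W × ¬ Bad W
  Nonspare Y = Beside Y × ¬ Spare Y

  above? : Decidable Above
  above? W = W ∈F? F ×-dec (u ∈? W ×-dec v ∈? W)

  beside? : Decidable Beside
  beside? Y = Y ∈F? F ×-dec ¬? (u ∈? Y ×-dec v ∈? Y)

  nonbad? : Decidable Nonbad
  nonbad? W = above? W ×-dec ¬? (bad? W)

  nonspare? : Decidable Nonspare
  nonspare? Y = beside? Y ×-dec ¬? (spare? Y)

  -- `W` is recovered from its image by adding `u` and `v`. The order of preference keeps the images
  -- off the spare members.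
  nonbad≤nonspare : length (select nonbad?) ≤ length (select nonspare?)
  nonbad≤nonspare = injection⇒length≤ (λ W Y → Y ∖ u ∖ v ≡ W ∖ u ∖ v) (select-unique nonbad?)
    (λ W∈ → let Y , ns , eq = image (∈-select⁻ nonbad? W∈) in Y , ∈-select⁺ nonspare? ns , eq)
    (λ W∈ W′∈ eq eq′ → ⊆-antisym
      (∖∖-injective (proj₂ (proj₁ (∈-select⁻ nonbad? W′∈))) (trans (sym eq) eq′))
      (∖∖-injective (proj₂ (proj₁ (∈-select⁻ nonbad? W∈))) (trans (sym eq′) eq)))
    where
    self∉ : ∀ W w → w ∉ W ∖ w
    self∉ W w w∈ = proj₂ (∈∖⁻ W w∈) refl

    ∖∖-swap : ∀ W → W ∖ v ∖ u ≡ W ∖ u ∖ v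
    ∖∖-swap W = ⊆-antisym
      (λ x∈ → let x∈′ , x≢u = ∈∖⁻ (W ∖ v) x∈ ; x∈W , x≢v = ∈∖⁻ W x∈′ in ∈∖∖⁺ x∈W x≢u x≢v)
      (λ x∈ → let x∈W , x≢u , x≢v = ∈∖∖⁻ W x∈ in ∈∖⁺ (∈∖⁺ x∈W x≢v) x≢u)

    ∖-idem : ∀ W w → W ∖ w ∖ w ≡ W ∖ w
    ∖-idem W w = ⊆-antisym (proj₁ ∘ ∈∖⁻ (W ∖ w)) (λ x∈ → ∈∖⁺ x∈ (proj₂ (∈∖⁻ W x∈)))

    image : ∀ {W} → Nonbad W → ∃ λ Y → Nonspare Y × Y ∖ u ∖ v ≡ W ∖ u ∖ v
    image {W} ((W∈F , (u∈W , v∈W)) , ¬bad) with W ∖ u ∖ v ∈F? F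
    ... | yes S∈F = W ∖ u ∖ v ,
      ((S∈F , v∉ ∘ proj₂) , [ u∉ ∘ proj₁ , v∉ ∘ proj₁ ]′ ∘ proj₂) ,
      trans (cong (_∖ v) (trans (∖∖-swap (W ∖ u)) (cong (_∖ v) (∖-idem W u)))) (∖-idem (W ∖ u) v)
      where
      v∉ : v ∉ W ∖ u ∖ v
      v∉ = self∉ (W ∖ u) v
      u∉ : u ∉ W ∖ u ∖ v
      u∉ = self∉ W u ∘ proj₁ ∘ ∈∖⁻ (W ∖ u)
    ... | no S∉F with W ∖ v ∈F? F
    -- Were this image spare, `W ∖ u ∖ v` would be in `F` and would have been chosen first.
    ...   | yes W∖v∈F = W ∖ v ,
      ((W∖v∈F , self∉ W v ∘ proj₂) ,
       [ (λ (_ , _ , S∈F) → S∉F (subst (_∈F F) (∖∖-swap W) S∈F)) , self∉ W v ∘ proj₁ ]′ ∘ proj₂) ,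
      trans (cong (_∖ v) (∖∖-swap W)) (∖-idem (W ∖ u) v)
    ...   | no W∖v∉F with W ∖ u ∈F? F
    ...     | no W∖u∉F = ⊥-elim (¬bad (W∈F , (u∈W , v∈W) , S∉F , W∖u∉F , W∖v∉F))
    -- Exchanging `v` for `u` in this image gives `W ∖ v`, already known not to be in `F`.
    ...     | yes W∖u∈F = W ∖ u ,
      ((W∖u∈F , self∉ W u ∘ proj₁) ,
       [ self∉ W u ∘ proj₁ , (λ (_ , _ , E) → W∖v∉F (subst (_∈F F) restored E)) ]′ ∘ proj₂) ,
      cong (_∖ v) (∖-idem W u)
      where
      restored : W ∖ u ∖ v ∪ ⁅ u ⁆ ≡ W ∖ v
      restored = trans (cong (_∪ ⁅ u ⁆) (sym (∖∖-swap W))) (∖∪⁅⁆ {W = W ∖ v} (∈∖⁺ u∈W u≢v))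

  above≤beside : ∣ A ∣ ≤ ∣ B ∣ → length (select above?) ≤ length (select beside?)
  above≤beside A≤B = begin
    length (select above?)
      ≤⟨ unique-⊆⇒length≤ (select-unique above?) classify ⟩
    length (select bad? ++ select nonbad?)
      ≡⟨ length-++ (select bad?) ⟩
    length (select bad?) + length (select nonbad?)
      ≤⟨ ℕ.+-mono-≤ (bad≤spare A≤B) nonbad≤nonspare ⟩
    length (select spare?) + length (select nonspare?)
      ≡⟨ length-++ (select spare?) ⟨
    length (select spare? ++ select nonspare?)
      ≤⟨ unique-⊆⇒length≤
           (Unique.++⁺ (select-unique spare?) (select-unique nonspare?) disjoint) merge ⟩
    length (select beside?) ∎
    where
    open ℕ.≤-Reasoning

    classify : ∀ {W} → W ∈ₗ select above? → W ∈ₗ select bad? ++ select nonbad?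
    classify {W} W∈ with bad? W
    ... | yes bad = ∈-++⁺ˡ (∈-select⁺ bad? bad)
    ... | no ¬bad = ∈-++⁺ʳ (select bad?) (∈-select⁺ nonbad? (∈-select⁻ above? W∈ , ¬bad))

    disjoint : ∀ {Y} → ¬ (Y ∈ₗ select spare? × Y ∈ₗ select nonspare?)
    disjoint (Y∈ , Y∈′) = proj₂ (∈-select⁻ nonspare? Y∈′) (∈-select⁻ spare? Y∈)

    merge : ∀ {Y} → Y ∈ₗ select spare? ++ select nonspare? → Y ∈ₗ select beside?
    merge Y∈ with ∈-++⁻ (select spare?) Y∈
    ... | inj₂ Y∈ns = ∈-select⁺ beside? (proj₁ (∈-select⁻ nonspare? Y∈ns))
    ... | inj₁ Y∈s with ∈-select⁻ spare? Y∈s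
    ...   | Y∈F , inj₁ (_ , v∉Y , _) = ∈-select⁺ beside? (Y∈F , v∉Y ∘ proj₂)
    ...   | Y∈F , inj₂ (_ , u∉Y , _) = ∈-select⁺ beside? (Y∈F , u∉Y ∘ proj₁)

-- Generators and degrees

∣p∣≡1⇒≡ : {p : Subset n} {x y : Fin n} → ∣ p ∣ ≡ 1 → x ∈ p → y ∈ p → x ≡ y
∣p∣≡1⇒≡ {p = p} {x} {y} p≡1 x∈p y∈p =
  sym (x∈⁅y⁆⇒x≡y x (⊆∧∣≥∣⇒⊇ (λ z∈ → subst (_∈ p) (sym (x∈⁅y⁆⇒x≡y x z∈)) x∈p)
    (ℕ.≤-reflexive (trans p≡1 (sym (∣⁅x⁆∣≡1 x)))) y∈p))

pair-from : {p : Subset n} {x y : Fin n} → ∣ p ∣ ≡ 2 → x ∈ p → y ∈ p → y ≢ x → p ≡ ⁅ x ⁆ ∪ ⁅ y ⁆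
pair-from {p = p} {x} {y} p≡2 x∈p y∈p y≢x = ⊆-antisym
  (⊆∧∣≥∣⇒⊇ (⁅⁆∪⁅⁆⊆ x∈p y∈p) (ℕ.≤-trans (ℕ.≤-reflexive (trans p≡2 (cong suc (sym (∣⁅x⁆∣≡1 x)))))
    (p⊂q⇒∣p∣<∣q∣ (p⊆p∪q ⁅ y ⁆ , y , ∈⁅⁆∪⁅⁆ʳ , y≢x ∘ x∈⁅y⁆⇒x≡y x))))
  (⁅⁆∪⁅⁆⊆ x∈p y∈p)

pair-at : {p : Subset n} {x : Fin n} → ∣ p ∣ ≡ 2 → x ∈ p → ∃ λ y → y ≢ x × p ≡ ⁅ x ⁆ ∪ ⁅ y ⁆
pair-at {p = p} {x} p≡2 x∈p with any? (λ y → y ∈? p ×-dec ¬? (y ≟ᶠ x))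
... | yes (y , y∈p , y≢x) = y , y≢x , pair-from p≡2 x∈p y∈p y≢x
... | no none = ⊥-elim (ℕ.<⇒≱ (s≤s (s≤s z≤n)) (subst₂ _≤_ p≡2 (∣⁅x⁆∣≡1 x) (p⊆q⇒∣p∣≤∣q∣ p⊆x)))
  where
  p⊆x : p ⊆ ⁅ x ⁆
  p⊆x {y} y∈p with y ≟ᶠ x
  ... | yes refl = x∈⁅x⁆ x
  ... | no y≢x = ⊥-elim (none (y , y∈p , y≢x))

pair-injective : {x y z : Fin n} → z ≢ x → ⁅ x ⁆ ∪ ⁅ y ⁆ ≡ ⁅ x ⁆ ∪ ⁅ z ⁆ → y ≡ z
pair-injective z≢x eq with ∈⁅⁆∪⁅⁆⁻ (subst (_ ∈_) (sym eq) ∈⁅⁆∪⁅⁆ʳ)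
... | inj₁ z≡x = ⊥-elim (z≢x z≡x)
... | inj₂ z≡y = sym z≡y

∈-members⁺ : (H : Family n) {W : Subset n} → W ∈F H → W ∈ₗ members H
∈-members⁺ H = ∈-select⁺ (T? ∘ H) ∘ Equivalence.from Bool.T-≡

∈-members⁻ : (H : Family n) {W : Subset n} → W ∈ₗ members H → W ∈F H
∈-members⁻ H = Equivalence.to Bool.T-≡ ∘ ∈-select⁻ (T? ∘ H)

∈-⋃⁻ : (ps : List (Subset n)) {x : Fin n} → x ∈ ⋃ ps → ∃ λ p → p ∈ₗ ps × x ∈ p
∈-⋃⁻ [] x∈ = ⊥-elim (∉⊥ x∈)
∈-⋃⁻ (p ∷ ps) x∈ with x∈p∪q⁻ p (⋃ ps) x∈
... | inj₁ x∈p = p , here refl , x∈p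
... | inj₂ x∈ps = let q , q∈ , x∈q = ∈-⋃⁻ ps x∈ps in q , there q∈ , x∈q

∈-unionBelow⁻ : (F : Family n) (W : Subset n) {x : Fin n} → x ∈ unionBelow F W
  → ∃ λ V → V ∈F F × V ⊆ W × V ≢ W × x ∈ V
∈-unionBelow⁻ F W x∈ with ∈-⋃⁻ (filterᵇ (λ V → properSubᵇ V W) (members F)) x∈
... | V , V∈ , x∈V with ∈-filter⁻ (λ V → T? (properSubᵇ V W)) {xs = members F} V∈
...   | V∈F , proper with Equivalence.to Bool.T-∧ proper
...     | V⊆W , V≢W =
  V , ∈-members⁻ F V∈F , toWitness {a? = V ⊆? W} V⊆W ,
  toWitnessFalse {a? = ≡-dec Bool._≟_ V W} V≢W , x∈V

-- Descent on cardinality: if `W` is not a generator, it is the union of the smaller members inside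
-- it, and one of these contains `x`.
generator-at : (F : Family n) {W : Subset n} {x : Fin n} → W ∈F F → x ∈ W
  → ∃ λ V → IsJ F V × x ∈ V × V ⊆ W
generator-at {n} F {W} = go W (<-wellFounded ∣ W ∣)
  where
  go : ∀ W {x} → Acc _<_ ∣ W ∣ → W ∈F F → x ∈ W → ∃ λ V → IsJ F V × x ∈ V × V ⊆ W
  go W {x} (acc rec) W∈F x∈W with ≡-dec Bool._≟_ W (unionBelow F W)
  ... | no W≢ = W , (W∈F , (x , x∈W) , W≢) , x∈W , ⊆-refl
  ... | yes W≡ with ∈-unionBelow⁻ F W (subst (x ∈_) W≡ x∈W)
  ...   | V , V∈F , V⊆W , V≢W , x∈V with go V (rec smaller) V∈F x∈V
    where
    smaller : ∣ V ∣ < ∣ W ∣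
    smaller = ℕ.≰⇒> (λ W≤V → V≢W (⊆-antisym V⊆W (⊆∧∣≥∣⇒⊇ V⊆W W≤V)))
  ...     | V′ , J , x∈V′ , V′⊆V = V′ , J , x∈V′ , ⊆-trans V′⊆V V⊆W

module Degree (H : Family n) where

  -- The list in the definition of `degree`, so that `degree H V` is its length by computation.
  incident : Subset n → List (Subset n)
  incident V = filterᵇ (λ W → not (eqᵇ W V) ∧ isYes (nonempty? (W ∩ V))) (members H)

  incident-unique : ∀ V → Unique (incident V)
  incident-unique V = Unique.filter⁺ (λ W → T? (not (eqᵇ W V) ∧ isYes (nonempty? (W ∩ V))))
    (select-unique (T? ∘ H))

  ∈-incident⁺ : ∀ {V W} → W ∈F H → W ≢ V → Nonempty (W ∩ V) → W ∈ₗ incident V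
  ∈-incident⁺ {V} {W} W∈H W≢V meets =
    ∈-filter⁺ (λ W → T? (not (eqᵇ W V) ∧ isYes (nonempty? (W ∩ V)))) (∈-members⁺ H W∈H)
      (Equivalence.from Bool.T-∧ (fromWitnessFalse {a? = ≡-dec Bool._≟_ W V} W≢V ,
        fromWitness {a? = nonempty? (W ∩ V)} meets))

  ∈-incident⁻ : ∀ V {W} → W ∈ₗ incident V → W ∈F H × W ≢ V × Nonempty (W ∩ V)
  ∈-incident⁻ V {W} W∈
    with ∈-filter⁻ (λ W → T? (not (eqᵇ W V) ∧ isYes (nonempty? (W ∩ V)))) {xs = members H} W∈
  ... | W∈H , conditions with Equivalence.to Bool.T-∧ conditions
  ...   | W≢V , meets = ∈-members⁻ H W∈H , toWitnessFalse {a? = ≡-dec Bool._≟_ W V} W≢V ,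
    toWitness {a? = nonempty? (W ∩ V)} meets

  module _ (simple : ∀ {W} → W ∈F H → ∣ W ∣ ≡ 2) (U : Subset n) where

    star? : ∀ w → Decidable (λ z → z ∉ U × (⁅ w ⁆ ∪ ⁅ z ⁆) ∈F H)
    star? w z = ¬? (z ∈? U) ×-dec (⁅ w ⁆ ∪ ⁅ z ⁆) ∈F? H

    star : Fin n → Subset n
    star w = ⟦ star? w ⟧

    module _ {u v x : Fin n} (U≡ : U ≡ ⁅ u ⁆ ∪ ⁅ v ⁆) (v≢u : v ≢ u) where

      private
        u∈U : u ∈ U
        u∈U = subst (u ∈_) (sym U≡) ∈⁅⁆∪⁅⁆ˡ
        v∈U : v ∈ U
        v∈U = subst (v ∈_) (sym U≡) ∈⁅⁆∪⁅⁆ʳ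

      -- Edges from `u` and from `v` to points outside `U` meet `U`, differ from `U`, and cannot
      -- coincide.
      stars≤degree : ∣ star u ∣ + ∣ star v ∣ ≤ degree H U
      stars≤degree = subst (_≤ degree H U)
        (trans (length-⊎ₗ (elements (star u)) (elements (star v)))
          (cong₂ _+_ (length-elements (star u)) (length-elements (star v))))
        (injection⇒length≤ Joins
          (⊎ₗ-unique (elements-unique (star u)) (elements-unique (star v))) image injective)
        where
        Joins : Fin n ⊎ Fin n → Subset n → Set
        Joins (inj₁ z) W = W ≡ ⁅ u ⁆ ∪ ⁅ z ⁆
        Joins (inj₂ z) W = W ≡ ⁅ v ⁆ ∪ ⁅ z ⁆

        Elements : List (Fin n ⊎ Fin n)
        Elements = elements (star u) ⊎ₗ elements (star v)

        in-star₁ : ∀ {z} → inj₁ z ∈ₗ Elements → z ∉ U × (⁅ u ⁆ ∪ ⁅ z ⁆) ∈F H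
        in-star₁ z∈ = ∈⟦⟧⁻ (star? u) (∈-elements⁻ (star u) (∈-⊎ₗ⁻ (elements (star u)) z∈))

        in-star₂ : ∀ {z} → inj₂ z ∈ₗ Elements → z ∉ U × (⁅ v ⁆ ∪ ⁅ z ⁆) ∈F H
        in-star₂ z∈ = ∈⟦⟧⁻ (star? v) (∈-elements⁻ (star v) (∈-⊎ₗ⁻ (elements (star u)) z∈))

        joined : ∀ {w z} → w ∈ U → z ∉ U × (⁅ w ⁆ ∪ ⁅ z ⁆) ∈F H → (⁅ w ⁆ ∪ ⁅ z ⁆) ∈ₗ incident U
        joined w∈U (z∉U , edge) = ∈-incident⁺ edge
          (λ eq → z∉U (subst (_ ∈_) eq ∈⁅⁆∪⁅⁆ʳ)) (_ , x∈p∩q⁺ (∈⁅⁆∪⁅⁆ˡ , w∈U))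

        image : ∀ {p} → p ∈ₗ Elements → ∃ λ W → W ∈ₗ incident U × Joins p W
        image {inj₁ z} z∈ = _ , joined u∈U (in-star₁ z∈) , refl
        image {inj₂ z} z∈ = _ , joined v∈U (in-star₂ z∈) , refl

        clash : ∀ {z z′} → z′ ∉ U → ⁅ u ⁆ ∪ ⁅ z ⁆ ≢ ⁅ v ⁆ ∪ ⁅ z′ ⁆
        clash z′∉U eq with ∈⁅⁆∪⁅⁆⁻ (subst (u ∈_) eq ∈⁅⁆∪⁅⁆ˡ)
        ... | inj₁ u≡v = v≢u (sym u≡v)
        ... | inj₂ refl = z′∉U u∈U

        ∉U⇒≢ : ∀ {w z} → w ∈ U → z ∉ U → z ≢ w
        ∉U⇒≢ w∈U z∉U refl = z∉U w∈U

        injective : ∀ {p p′ W} → p ∈ₗ Elements → p′ ∈ₗ Elements → Joins p W → Joins p′ W → p ≡ p′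
        injective {inj₁ _} {inj₁ _} p∈ p′∈ refl eq =
          cong inj₁ (pair-injective (∉U⇒≢ u∈U (proj₁ (in-star₁ p′∈))) eq)
        injective {inj₂ _} {inj₂ _} p∈ p′∈ refl eq =
          cong inj₂ (pair-injective (∉U⇒≢ v∈U (proj₁ (in-star₂ p′∈))) eq)
        injective {inj₁ _} {inj₂ _} p∈ p′∈ refl eq = ⊥-elim (clash (proj₁ (in-star₂ p′∈)) eq)
        injective {inj₂ _} {inj₁ _} p∈ p′∈ refl eq = ⊥-elim (clash (proj₁ (in-star₂ p∈)) (sym eq))

      -- The edges at u other than {u,x} are matched with star u: U, which is
      -- not in the star, takes the place of x.
      degree≤stars : x ∈ star u → x ∉ star v → degree H (⁅ u ⁆ ∪ ⁅ x ⁆) ≤ ∣ star u ∣ + ∣ star x ∣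
      degree≤stars x∈star x∉star = subst (degree H (⁅ u ⁆ ∪ ⁅ x ⁆) ≤_)
        (trans (length-⊎ₗ (elements (star u)) (elements (star x)))
          (cong₂ _+_ (length-elements (star u)) (length-elements (star x))))
        (injection⇒length≤ Matches (incident-unique (⁅ u ⁆ ∪ ⁅ x ⁆)) image injective)
        where
        x∉U : x ∉ U
        x∉U = proj₁ (∈⟦⟧⁻ (star? u) x∈star)

        Matches : Subset n → Fin n ⊎ Fin n → Set
        Matches W (inj₁ z) = (z ≡ x × W ≡ U) ⊎ (z ≢ x × W ≡ ⁅ u ⁆ ∪ ⁅ z ⁆)
        Matches W (inj₂ z) = W ≡ ⁅ x ⁆ ∪ ⁅ z ⁆

        ∉U : ∀ {z} → z ≢ u → z ≢ v → z ∉ U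
        ∉U z≢u z≢v z∈U = [ z≢u , z≢v ]′ (∈⁅⁆∪⁅⁆⁻ (subst (_ ∈_) U≡ z∈U))

        at-u : ∀ {z} → (⁅ u ⁆ ∪ ⁅ z ⁆) ∈F H → z ≢ u → z ≢ x
          → ∃ λ p → p ∈ₗ elements (star u) ⊎ₗ elements (star x) × Matches (⁅ u ⁆ ∪ ⁅ z ⁆) p
        at-u {z} edge z≢u z≢x with z ≟ᶠ v
        ... | yes refl = inj₁ x , ∈-⊎ₗ⁺ˡ (∈-elements⁺ x∈star) , inj₁ (refl , sym U≡)
        ... | no z≢v = inj₁ z , ∈-⊎ₗ⁺ˡ (∈-elements⁺ (∈⟦⟧⁺ (star? u) (∉U z≢u z≢v , edge))) ,
          inj₂ (z≢x , refl)

        at-x : ∀ {z} → (⁅ x ⁆ ∪ ⁅ z ⁆) ∈F H → z ≢ u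
          → ∃ λ p → p ∈ₗ elements (star u) ⊎ₗ elements (star x) × Matches (⁅ x ⁆ ∪ ⁅ z ⁆) p
        at-x {z} edge z≢u = inj₂ z ,
          ∈-⊎ₗ⁺ʳ (elements (star u)) (∈-elements⁺ (∈⟦⟧⁺ (star? x) (∉U z≢u z≢v , edge))) , refl
          where
          -- An edge between `x` and `v` would put `x` into `star v`.
          z≢v : z ≢ v
          z≢v refl = x∉star (∈⟦⟧⁺ (star? v) (x∉U , subst (_∈F H) (∪-comm ⁅ x ⁆ ⁅ v ⁆) edge))

        image : ∀ {W} → W ∈ₗ incident (⁅ u ⁆ ∪ ⁅ x ⁆)
          → ∃ λ p → p ∈ₗ elements (star u) ⊎ₗ elements (star x) × Matches W p
        image {W} W∈ with ∈-incident⁻ (⁅ u ⁆ ∪ ⁅ x ⁆) W∈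
        ... | W∈H , W≢ , (y , y∈) with u ∈? W
        ...   | yes u∈W with pair-at (simple W∈H) u∈W
        ...     | z , z≢u , refl = at-u W∈H z≢u (λ { refl → W≢ refl })
        image {W} W∈ | W∈H , W≢ , (y , y∈) | no u∉W
          with x∈p∩q⁻ W (⁅ u ⁆ ∪ ⁅ x ⁆) y∈
        ... | y∈W , y∈pair with ∈⁅⁆∪⁅⁆⁻ y∈pair
        ...   | inj₁ refl = ⊥-elim (u∉W y∈W)
        ...   | inj₂ refl with pair-at (simple W∈H) y∈W
        ...     | z , _ , refl = at-x W∈H (λ { refl → u∉W ∈⁅⁆∪⁅⁆ʳ })

        injective : ∀ {W W′ p} → W ∈ₗ incident (⁅ u ⁆ ∪ ⁅ x ⁆) → W′ ∈ₗ incident (⁅ u ⁆ ∪ ⁅ x ⁆)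
          → Matches W p → Matches W′ p → W ≡ W′
        injective {p = inj₁ z} _ _ (inj₁ (_ , eq)) (inj₁ (_ , eq′)) = trans eq (sym eq′)
        injective {p = inj₁ z} _ _ (inj₂ (_ , eq)) (inj₂ (_ , eq′)) = trans eq (sym eq′)
        injective {p = inj₁ z} _ _ (inj₁ (z≡x , _)) (inj₂ (z≢x , _)) = ⊥-elim (z≢x z≡x)
        injective {p = inj₁ z} _ _ (inj₂ (z≢x , _)) (inj₁ (z≡x , _)) = ⊥-elim (z≢x z≡x)
        injective {p = inj₂ z} _ _ eq eq′ = trans eq (sym eq′)

      -- The two degree estimates share the term |star u|, which cancels.
      star-degree : x ∈ star u → x ∉ star v
        → degree H U ≤ degree H (⁅ u ⁆ ∪ ⁅ x ⁆) → ∣ star v ∣ ≤ ∣ star x ∣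
      star-degree x∈star x∉star U≤V = ℕ.+-cancelˡ-≤ ∣ star u ∣ _ _
        (ℕ.≤-trans stars≤degree (ℕ.≤-trans U≤V (degree≤stars x∈star x∉star)))

-- From the count to the density property

density-≤ : (F : Family n) (U : Subset n) → UnionClosed F → ⊥ ∈F F
  → {u v : Fin n} → U ≡ ⁅ u ⁆ ∪ ⁅ v ⁆ → (nbhd : Neighbourhoods F u v)
  → ∣ Neighbourhoods.A nbhd ∣ ≤ ∣ Neighbourhoods.B nbhd ∣ → DensityProperty F U
density-≤ {n} F U closed ⊥∈F {u} {v} refl nbhd A≤B = begin
  2 * card aboveU
    ≤⟨ ℕ.*-monoʳ-≤ 2 (unique-⊆⇒length≤ (select-unique (T? ∘ aboveU)) to-above) ⟩
  2 * length (select above?)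
    ≡⟨ cong (length (select above?) +_) (ℕ.+-identityʳ (length (select above?))) ⟩
  length (select above?) + length (select above?)
    ≤⟨ ℕ.+-monoʳ-≤ (length (select above?)) (above≤beside A≤B) ⟩
  length (select above?) + length (select beside?)
    ≡⟨ length-++ (select above?) ⟨
  length (select above? ++ select beside?)
    ≤⟨ unique-⊆⇒length≤ (Unique.++⁺ (select-unique above?) (select-unique beside?) disjoint)
         to-members ⟩
  card F ∎
  where
  open ℕ.≤-Reasoning
  open Density F closed ⊥∈F nbhd

  aboveU : Family n
  aboveU W = F W ∧ isYes (U ⊆? W)

  to-above : ∀ {W} → W ∈ₗ members aboveU → W ∈ₗ select above?
  to-above {W} W∈ with Equivalence.to (Bool.T-∧ {F W}) (∈-select⁻ (T? ∘ aboveU) W∈)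
  ... | W∈F , U⊆W = ∈-select⁺ above? (Equivalence.to Bool.T-≡ W∈F ,
    toWitness {a? = U ⊆? W} U⊆W ∈⁅⁆∪⁅⁆ˡ , toWitness {a? = U ⊆? W} U⊆W ∈⁅⁆∪⁅⁆ʳ)

  disjoint : ∀ {W} → ¬ (W ∈ₗ select above? × W ∈ₗ select beside?)
  disjoint (W∈ , W∈′) = proj₂ (∈-select⁻ beside? W∈′) (proj₂ (∈-select⁻ above? W∈))

  to-members : ∀ {W} → W ∈ₗ select above? ++ select beside? → W ∈ₗ members F
  to-members W∈ with ∈-++⁻ (select above?) W∈
  ... | inj₁ W∈a = ∈-members⁺ F (proj₁ (∈-select⁻ above? W∈a))
  ... | inj₂ W∈b = ∈-members⁺ F (proj₁ (∈-select⁻ beside? W∈b))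

density : (F : Family n) (U : Subset n) → UnionClosed F → ⊥ ∈F F
  → {u v : Fin n} → U ≡ ⁅ u ⁆ ∪ ⁅ v ⁆ → Neighbourhoods F u v → DensityProperty F U
density F U closed ⊥∈F {u} {v} U≡ nbhd with ℕ.≤-total ∣ A ∣ ∣ B ∣
  where open Neighbourhoods nbhd
... | inj₁ A≤B = density-≤ F U closed ⊥∈F U≡ nbhd A≤B
... | inj₂ B≤A =
  density-≤ F U closed ⊥∈F (trans U≡ (∪-comm ⁅ u ⁆ ⁅ v ⁆)) (exchange nbhd) B≤A

theorem3p31 : (n : ℕ) (F : Family n) (U : Subset n)
    → UnionClosed F
    → ⊥ ∈F F
    → IsJ F U
    → ∣ U ∣ ≡ 2
    → (∀ V → IsJ F V → Nonempty (V ∩ U) → ∣ V ∣ ≡ 1 ⊎ ∣ V ∣ ≡ 2)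
    → Σ (Family n) (λ G' →
    (∀ W → W ∈F G' → IsJ F W × ∣ W ∣ ≡ 2)
    × (∀ V → IsJ F V → Nonempty (V ∩ U) → ∣ V ∣ ≡ 2
    → V ∈F G' × degree G' U ≤ degree G' V))
    → DensityProperty F U
theorem3p31 n F U closed ⊥∈F (U∈F , (u , u∈U) , U≢) ∣U∣≡2 small (G' , G'⊆J , G'-degree)
  with pair-at ∣U∣≡2 u∈U
... | v , v≢u , U≡ = density F U closed ⊥∈F U≡ record
  -- `nbrs w` omits the points of `U` for every `w`, which gives `N-avoids`.
  { A = nbrs u ; B = nbrs v ; N = nbrs ; u≢v = v≢u ∘ sym
  ; A-edge = edge ; B-edge = edge ; N-edge = edge
  ; N-avoids = λ z∈ → (λ { refl → proj₁ (∈⟦⟧⁻ (nbr? _) z∈) u∈U })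
                    , (λ { refl → proj₁ (∈⟦⟧⁻ (nbr? _) z∈) v∈U })
  ; A-degree = λ x∈ x∉ → star-degree simple U U≡ v≢u x∈ x∉ (minimal u∈U x∈)
  ; B-degree = λ x∈ x∉ → star-degree simple U (trans U≡ (∪-comm ⁅ u ⁆ ⁅ v ⁆)) (v≢u ∘ sym)
      x∈ x∉ (minimal v∈U x∈)
  ; cover = cover
  }
  where
  open Degree G'

  simple : ∀ {W} → W ∈F G' → ∣ W ∣ ≡ 2
  simple {W} = proj₂ ∘ G'⊆J W

  nbr? : ∀ w → Decidable (λ z → z ∉ U × (⁅ w ⁆ ∪ ⁅ z ⁆) ∈F G')
  nbr? = star? simple U

  nbrs : Fin n → Subset n
  nbrs = star simple U

  v∈U : v ∈ U
  v∈U = subst (v ∈_) (sym U≡) ∈⁅⁆∪⁅⁆ʳ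

  edge : ∀ {w z} → z ∈ nbrs w → (⁅ w ⁆ ∪ ⁅ z ⁆) ∈F F
  edge {w} z∈ = proj₁ (proj₁ (G'⊆J _ (proj₂ (∈⟦⟧⁻ (nbr? w) z∈))))

  minimal : ∀ {w x} → w ∈ U → x ∈ nbrs w → degree G' U ≤ degree G' (⁅ w ⁆ ∪ ⁅ x ⁆)
  minimal {w} w∈U x∈ = let J , size = G'⊆J _ (proj₂ (∈⟦⟧⁻ (nbr? w) x∈)) in
    proj₂ (G'-degree _ J (w , x∈p∩q⁺ (∈⁅⁆∪⁅⁆ˡ , w∈U)) size)

  in-star : ∀ {V w x} → V ∈F G' → w ∈ V → x ∈ V → w ∈ U → x ∉ U → x ∈ nbrs w
  in-star {V} {w} V∈G' w∈V x∈V w∈U x∉U = ∈⟦⟧⁺ (nbr? w)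
    (x∉U , subst (_∈F G') (pair-from (simple V∈G') w∈V x∈V λ { refl → x∉U w∈U }) V∈G')

  -- Take a generator inside `W` that contains `x`. Either it avoids `U`, or it must be an edge of
  -- `G'` joining `x` to `u` or `v`.
  cover : ∀ {W x} → W ∈F F → x ∈ W → x ≢ u → x ≢ v
    → x ∈ nbrs u ⊎ x ∈ nbrs v ⊎ ∃ λ V → V ∈F F × x ∈ V × V ⊆ W × u ∉ V × v ∉ V
  cover {W} {x} W∈F x∈W x≢u x≢v with generator-at F W∈F x∈W
  ... | V , J , x∈V , V⊆W with nonempty? (V ∩ U)
  ...   | no disjoint = inj₂ (inj₂ (V , proj₁ J , x∈V , V⊆W ,
    (λ u∈V → disjoint (u , x∈p∩q⁺ (u∈V , u∈U))) , λ v∈V → disjoint (v , x∈p∩q⁺ (v∈V , v∈U))))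
  ...   | yes (w , w∈) with x∈p∩q⁻ V U w∈
  ...     | w∈V , w∈U = near (∈⁅⁆∪⁅⁆⁻ (subst (w ∈_) U≡ w∈U))
    where
    x∉U : x ∉ U
    x∉U x∈U = [ x≢u , x≢v ]′ (∈⁅⁆∪⁅⁆⁻ (subst (x ∈_) U≡ x∈U))
    V∈G' : V ∈F G'
    V∈G' with small V J (w , w∈)
    -- A singleton that meets `U` and contains `x` would place `x` in `U`.
    ... | inj₁ size₁ = ⊥-elim (x∉U (subst (_∈ U) (∣p∣≡1⇒≡ size₁ w∈V x∈V) w∈U))
    ... | inj₂ size₂ = proj₁ (G'-degree V J (w , w∈) size₂)
    near : w ≡ u ⊎ w ≡ v → x ∈ nbrs u ⊎ x ∈ nbrs v ⊎ _
    near (inj₁ refl) = inj₁ (in-star V∈G' w∈V x∈V w∈U x∉U)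
    near (inj₂ refl) = inj₂ (inj₁ (in-star V∈G' w∈V x∈V w∈U x∉U))
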